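{- Let $p$ be a prime with $p\ne 3$, let $q=p^k$ where $k$ is a positive integer, let $Q,R,S\in\{p^i : i\ge 0\}$, let $\omega\in\mathbb{F}_{q^2}^*$ be an element of multiplicative order $3$, let $z\in\{1,2\}$, and put $r=Q+R+S$. Let $B_z^{(1)}(X)$ and $B_z^{(2)}(X)$ be the polynomials defined in the context, and let $f_1(X) := X^{r} B_z^{(1)}(X^{q-1})$ and $f_2(X) := X^{r} B_z^{(2)}(X^{q-1})$, viewed as functions $\mathbb{F}_{q^2}\to\mathbb{F}_{q^2}$. Then: (1) if $q\equiv 1\pmod 3$ then $f_1$ is $\mathbb{F}_q$-linearly equivalent to the function $x\mapsto x^{Q+R+S}$ on $\mathbb{F}_{q^2}$; (2) if $q\equiv 2\pmod 3$ then $f_1$ is $\mathbb{F}_q$-linearly equivalent to the function $(x,y)\mapsto (x^{Q+R+S},y^{Q+R+S})$ on $\mathbb{F}_q\times\mathbb{F}_q$; (3) if $q\equiv 1\pmod 3$ then $f_2$ is $\mathbb{F}_q$-linearly equivalent to the function $x\mapsto x^{Q+qR+S}$ on $\mathbb{F}_{q^2}$; (4) if $q\equiv 2\pmod 3$ then $f_2$ is $\mathbb{F}_q$-linearly equivalent to the function $(x,y)\mapsto (x^{Q+S}y^R,\,x^Ry^{Q+S})$ on $\mathbb{F}_q\times\mathbb{F}_q$.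
   Context: Linear equivalence: if $U$ and $V$ are $\mathbb{F}_q$-vector spaces, a function $f\colon U\to U$ is $\mathbb{F}_q$-linearly equivalent to a function $g\colon V\to V$ if $f=\rho\circ g\circ\eta$ for some $\mathbb{F}_q$-vector space isomorphisms $\rho\colon V\to U$ and $\eta\colon U\to V$. First family of polynomials: define \begin{align*} C_1^{(1)}(X) := {} & (\omega^{Q+R+S}-\omega) X^{Q+R+S} + (\omega^{Q+R}-\omega^{S+1}) X^{Q+R} \\ & + (\omega^{Q+S}-\omega^{R+1}) X^{Q+S} + (\omega^{R+S}-\omega^{Q+1}) X^{R+S} \\ & + (\omega^Q-\omega^{R+S+1}) X^Q + (\omega^R-\omega^{Q+S+1}) X^R \\ & + (\omega^S-\omega^{Q+R+1}) X^S + (1-\omega^{Q+R+S+1}), \end{align*} $C_2^{(1)}(X) := X^{Q+R+S} C_1^{(1)}(1/X)$, and let $\beta_1=\omega^{Q+R}-\omega^{S+1}$ if $Q+R+S\equiv 1\pmod 3$, and $\beta_1=\omega^{Q+R+S}-\omega$ otherwise. Put $B_z^{(1)}(X) := C_z^{(1)}(X)/\beta_1$ for $z\in\{1,2\}$. Second family of polynomials: define \begin{align*} C_1^{(2)}(X) := {} & (\omega^{Q+S}-\omega^{R+1}) X^{Q+R+S} + (\omega^Q-\omega^{R+S+1}) X^{Q+R} \\ & + (\omega^{Q+R+S}-\omega) X^{Q+S} + (\omega^S-\omega^{Q+R+1}) X^{R+S} \\ & + (\omega^{Q+R}-\omega^{S+1}) X^Q + (1-\omega^{Q+R+S+1}) X^R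 \\ & + (\omega^{R+S}-\omega^{Q+1}) X^S + (\omega^R-\omega^{Q+S+1}), \end{align*} $C_2^{(2)}(X) := X^{Q+R+S} C_1^{(2)}(1/X)$, and let $\beta_2=\omega^Q-\omega^{R+S+1}$ if $Q+S\equiv R+1\pmod 3$, and $\beta_2=\omega^{Q+S}-\omega^{R+1}$ otherwise. Put $B_z^{(2)}(X) := C_z^{(2)}(X)/\beta_2$ for $z\in\{1,2\}$. -}

module Defs where

open import Algebra.Bundles using (CommutativeRing)
import Algebra.Module.Construct.DirectProduct as DirectProduct
import Algebra.Module.Construct.TensorUnit as TensorUnit
open import Algebra.Module.Bundles using (Module)
open import Algebra.Module.Morphism.Structures using (IsModuleIsomorphism)
open import Algebra.Morphism.Structures using (IsRingHomomorphism)
import Algebra.Properties.Semiring.Exp as Exp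
open import Data.Bool using (if_then_else_)
open import Data.Fin using (Fin; zero; suc)
open import Data.List using (List; []; _∷_; map; foldr)
open import Data.Nat using (ℕ; _<_; _∸_; _≟_; _%_)
import Data.Nat as Nat
open import Data.Product using (_×_; _,_; ∃-syntax)
open import Function.Bundles using (Inverse)
open import Level using (Level; _⊔_)
open import Relation.Binary.Bundles using (Setoid)
open import Relation.Binary.PropositionalEquality as ≡ using (_≡_)
open import Relation.Nullary.Decidable using (does)

private
  variable
    a b c ℓ c′ ℓ′ r ℓr m ℓm m′ ℓm′ : Level

-- The fields used are finite, so their equality is decidable and the classical
-- axiom "every nonzero element is invertible" is the appropriate one; the
-- library's HeytingField would only add an apartness relation.  The value of
-- 0# ⁻¹ is left unspecified.
record Field c ℓ : Set (Level.suc (c ⊔ ℓ)) where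
  infix 9 _⁻¹
  field
    commutativeRing : CommutativeRing c ℓ

  open CommutativeRing commutativeRing public
  open Exp semiring public using (_^_)

  field
    _⁻¹       : Carrier → Carrier
    0≉1       : 0# ≉ 1#
    *-inverse : ∀ x → x ≉ 0# → x * x ⁻¹ ≈ 1#

  HasOrder : Carrier → ℕ → Set ℓ
  HasOrder x n =
    0 < n × x ^ n ≈ 1# × (∀ i → 0 < i → i < n → x ^ i ≉ 1#)

HasCardinality : Setoid a b → ℕ → Set (a ⊔ b)
HasCardinality A n = Inverse A (≡.setoid (Fin n))

PowerOf : ℕ → ℕ → Set
PowerOf p n = ∃[ i ] n ≡ p Nat.^ i

module _ {R : CommutativeRing r ℓr}
         (U : Module R m ℓm) (V : Module R m′ ℓm′) where
  private
    module U = Module U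
    module V = Module V

  LinearlyEquivalent : (U.Carrierᴹ → U.Carrierᴹ) → (V.Carrierᴹ → V.Carrierᴹ) →
                       Set (r ⊔ m ⊔ ℓm ⊔ m′ ⊔ ℓm′)
  LinearlyEquivalent f g =
    ∃[ ρ ] ∃[ η ]
      IsModuleIsomorphism V.rawModule U.rawModule ρ ×
      IsModuleIsomorphism U.rawModule V.rawModule η ×
      (∀ u → f u U.≈ᴹ ρ (g (η u)))

-- K as a vector space over F, with scalars acting through ι : F → K.
module _ (F : Field c ℓ) (K : Field c′ ℓ′)
         {ι : Field.Carrier F → Field.Carrier K}
         (ι-hom : IsRingHomomorphism (Field.rawRing F) (Field.rawRing K) ι) where
  private
    module F = Field F
    module ι = IsRingHomomorphism ι-hom
  open Field K

  extensionModule : Module F.commutativeRing c′ ℓ′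
  extensionModule = record
    { Carrierᴹ = Carrier
    ; _≈ᴹ_     = _≈_
    ; _+ᴹ_     = _+_
    ; _*ₗ_     = λ s x → ι s * x
    ; _*ᵣ_     = λ x s → x * ι s
    ; 0ᴹ       = 0#
    ; -ᴹ_      = -_
    ; isModule = record
      { isBimodule = record
        { isBisemimodule = record
          { +ᴹ-isCommutativeMonoid = +-isCommutativeMonoid
          ; isPreleftSemimodule = record
            { *ₗ-cong      = λ s≈t x≈y → *-cong (ι.⟦⟧-cong s≈t) x≈y
            ; *ₗ-zeroˡ     = λ x → trans (*-congʳ ι.0#-homo) (zeroˡ x)
            ; *ₗ-distribʳ  = λ x s t →
                trans (*-congʳ (ι.+-homo s t)) (distribʳ x (ι s) (ι t))
            ; *ₗ-identityˡ = λ x → trans (*-congʳ ι.1#-homo) (*-identityˡ x)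
            ; *ₗ-assoc     = λ s t x →
                trans (*-congʳ (ι.*-homo s t)) (*-assoc (ι s) (ι t) x)
            ; *ₗ-zeroʳ     = λ s → zeroʳ (ι s)
            ; *ₗ-distribˡ  = λ s → distribˡ (ι s)
            }
          ; isPrerightSemimodule = record
            { *ᵣ-cong      = λ x≈y s≈t → *-cong x≈y (ι.⟦⟧-cong s≈t)
            ; *ᵣ-zeroʳ     = λ x → trans (*-congˡ ι.0#-homo) (zeroʳ x)
            ; *ᵣ-distribˡ  = λ x s t →
                trans (*-congˡ (ι.+-homo s t)) (distribˡ x (ι s) (ι t))
            ; *ᵣ-identityʳ = λ x → trans (*-congˡ ι.1#-homo) (*-identityʳ x)
            ; *ᵣ-assoc     = λ x s t →
                trans (*-assoc x (ι s) (ι t)) (*-congˡ (sym (ι.*-homo s t)))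
            ; *ᵣ-zeroˡ     = λ s → zeroˡ (ι s)
            ; *ᵣ-distribʳ  = λ s → distribʳ (ι s)
            }
          ; *ₗ-*ᵣ-assoc = λ s x t → *-assoc (ι s) x (ι t)
          }
        ; -ᴹ‿cong    = -‿cong
        ; -ᴹ‿inverse = -‿inverse
        }
      ; *ₗ-*ᵣ-coincident = λ s x → *-comm (ι s) x
      }
    }

squareModule : (F : Field c ℓ) → Module (Field.commutativeRing F) c ℓ
squareModule F = DirectProduct.⟨module⟩ TensorUnit.⟨module⟩ TensorUnit.⟨module⟩

module Polynomial (K : Field c ℓ) where
  open Field K

  -- A list of monomials (coefficient , exponent) standing for its sum;
  -- exponents may repeat (e.g. X^Q and X^R when Q = R).
  Poly : Set c
  Poly = List (Carrier × ℕ)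

  eval : Poly → Carrier → Carrier
  eval P x = foldr (λ (a , e) s → a * x ^ e + s) 0# P

  scale : Carrier → Poly → Poly
  scale t = map (λ (a , e) → t * a , e)

  -- X^d P(1/X), provided all exponents occurring in P are at most d.
  reciprocal : ℕ → Poly → Poly
  reciprocal d = map (λ (a , e) → a , d ∸ e)

module Families (K : Field c ℓ) (ω : Field.Carrier K) (Q R S : ℕ) where
  open Nat using (_+_)
  open Field K hiding (_+_; zero)
  open Polynomial K

  C₁⁽¹⁾ : Poly
  C₁⁽¹⁾ = (ω ^ (Q + R + S) - ω           , Q + R + S)
        ∷ (ω ^ (Q + R) - ω ^ (S + 1)     , Q + R)
        ∷ (ω ^ (Q + S) - ω ^ (R + 1)     , Q + S)
        ∷ (ω ^ (R + S) - ω ^ (Q + 1)     , R + S)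
        ∷ (ω ^ Q - ω ^ (R + S + 1)       , Q)
        ∷ (ω ^ R - ω ^ (Q + S + 1)       , R)
        ∷ (ω ^ S - ω ^ (Q + R + 1)       , S)
        ∷ (1# - ω ^ (Q + R + S + 1)      , 0)
        ∷ []

  C₁⁽²⁾ : Poly
  C₁⁽²⁾ = (ω ^ (Q + S) - ω ^ (R + 1)     , Q + R + S)
        ∷ (ω ^ Q - ω ^ (R + S + 1)       , Q + R)
        ∷ (ω ^ (Q + R + S) - ω           , Q + S)
        ∷ (ω ^ S - ω ^ (Q + R + 1)       , R + S)
        ∷ (ω ^ (Q + R) - ω ^ (S + 1)     , Q)
        ∷ (1# - ω ^ (Q + R + S + 1)      , R)
        ∷ (ω ^ (R + S) - ω ^ (Q + 1)     , S)
        ∷ (ω ^ R - ω ^ (Q + S + 1)       , 0)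
        ∷ []

  -- The index z ∈ {1,2} is represented by Fin 2: zero is z = 1, suc zero is z = 2.
  C⁽¹⁾ : Fin 2 → Poly
  C⁽¹⁾ zero       = C₁⁽¹⁾
  C⁽¹⁾ (suc zero) = reciprocal (Q + R + S) C₁⁽¹⁾

  C⁽²⁾ : Fin 2 → Poly
  C⁽²⁾ zero       = C₁⁽²⁾
  C⁽²⁾ (suc zero) = reciprocal (Q + R + S) C₁⁽²⁾

  β₁ : Carrier
  β₁ = if does ((Q + R + S) % 3 ≟ 1)
       then ω ^ (Q + R) - ω ^ (S + 1)
       else ω ^ (Q + R + S) - ω

  β₂ : Carrier
  β₂ = if does ((Q + S) % 3 ≟ (R + 1) % 3)
       then ω ^ Q - ω ^ (R + S + 1)
       else ω ^ (Q + S) - ω ^ (R + 1)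

  -- β₁ and β₂ are nonzero when ω has order 3 and Q, R, S are prime to 3.
  B⁽¹⁾ : Fin 2 → Poly
  B⁽¹⁾ z = scale (β₁ ⁻¹) (C⁽¹⁾ z)

  B⁽²⁾ : Fin 2 → Poly
  B⁽²⁾ z = scale (β₂ ⁻¹) (C⁽²⁾ z)

  f₁ : ℕ → Fin 2 → Carrier → Carrier
  f₁ q z x = x ^ (Q + R + S) * eval (B⁽¹⁾ z) (x ^ (q ∸ 1))

  f₂ : ℕ → Fin 2 → Carrier → Carrier
  f₂ q z x = x ^ (Q + R + S) * eval (B⁽²⁾ z) (x ^ (q ∸ 1))

{-# OPTIONS --safe #-}
module Submission where

-- Write x̄ = x^q, A = x + ω x̄ and B = x̄ + ω x.  Since Q, R and S are powers of the
-- characteristic, the eight coefficients of each family are exactly those making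
--   β₁ f₁(x) = A^(Q+R+S) − ω B^(Q+R+S)   and   β₂ f₂(x) = A^(Q+S) B^R − ω B^(Q+S) A^R
-- for z = 1; the polynomials for z = 2 are reciprocal, which replaces x by x̄.
-- If q ≡ 1 (mod 3), then ω ∈ F_q, so B = Ā, and both x ↦ A and y ↦ y − ω ȳ are bijective.
-- If q ≡ 2 (mod 3), then ω ∉ F_q, so F_q × F_q ≅ F_{q²} by (a, b) ↦ (1 − ω²)(a − ω b), and in
-- these coordinates A and B are the same scalar multiple of a and b respectively.
-- Bijectivity of linear maps is obtained from a trivial kernel by counting, so that no
-- dimension theory and no description of F_q as a fixed field are needed.

open import Defs
open import Algebra.Bundles using (CommutativeMonoid; CommutativeRing; CommutativeSemiring)
open import Algebra.Module.Bundles using (Module)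
open import Algebra.Module.Morphism.Structures using (IsModuleIsomorphism)
open import Algebra.Morphism.Structures using (IsRingHomomorphism)
import Algebra.Properties.AbelianGroup as AbelianGroupProperties
import Algebra.Properties.CommutativeMonoid.Sum as Sum
import Algebra.Properties.CommutativeSemiring.Binomial as Binomial
import Algebra.Properties.CommutativeSemiring.Exp as CommutativeExp
import Algebra.Properties.Group as GroupProperties
import Algebra.Properties.Ring as RingProperties
import Algebra.Properties.Semiring.Exp as SemiringExp
import Algebra.Properties.Semiring.Mult as SemiringMult
import Algebra.Solver.Ring.NaturalCoefficients.Default as SemiringSolver
open import Data.Bool using (if_then_else_)
open import Data.Fin using (Fin; zero; suc; combine; fromℕ; inject₁; punchIn; punchOut; remQuot; toℕ)
open import Data.Fin.Permutation using (Permutation; permutation)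
open import Data.Fin.Properties using (any?; combine-remQuot; injective⇒≤; punchInᵢ≢i; punchOut-injective; remQuot-combine; toℕ-fromℕ; toℕ-inject₁; toℕ<n) renaming (_≟_ to _≟ᶠ_)
open import Data.List using ([]; _∷_)
open import Data.List.Relation.Unary.All using (All; []; _∷_)
import Data.Nat as Nat
open import Data.Nat using (ℕ; zero; suc; _∸_; _/_; _%_; _≤_; _<_; _!; z≤n; s≤s; nonTrivial⇒≢1)
open import Data.Nat.Combinatorics using (_C_; k![n∸k]!∣n!; nCk≡n!/k![n-k]!; nCn≡1)
open import Data.Nat.DivMod using (m/n*n≡m; m%n<n; m≡m%n+[m/n]*n)
open import Data.Nat.Divisibility using (_∣_; _∣?_; _∤_; divides; m%n≡0⇒n∣m; m∣m*n; ∣1⇒≡1; ∣⇒≤)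
open import Data.Nat.Primality using (Prime; euclidsLemma; prime?; prime⇒irreducible; prime⇒nonTrivial; prime⇒nonZero)
import Data.Nat.Properties as ℕ
open import Data.Nat.Tactic.RingSolver using (solve-∀)
open import Data.Product using (_×_; _,_; proj₁; proj₂; ∃-syntax)
open import Data.Product.Relation.Binary.Pointwise.NonDependent using (×-setoid)
open import Data.Sum using (inj₁; inj₂; [_,_]′)
open import Data.Vec.Functional using (replicate)
open import Function.Base using (_∘_; id)
open import Function.Bundles using (Inverse)
open import Function.Definitions using (Congruent; Injective; Surjective)
open import Level using (Level)
open import Relation.Binary.Bundles using (Setoid)
open import Relation.Binary.Definitions using (Decidable; tri<; tri≈; tri>)
open import Relation.Binary.PropositionalEquality as ≡ using (_≡_; _≢_)
import Relation.Binary.Reasoning.Setoid as SetoidReasoning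
open import Relation.Nullary using (¬_; Dec; yes; no; contradiction)
open import Relation.Nullary.Decidable using (does; from-no; from-yes; map′)

-- The coefficients come from expanding a product. As n ↦ x^n is additive for n = Q, R, S, each
-- factor A^n is x^n + ω^n x̄^n. Choosing x̄ for the exponents in a subset T of {Q, R, S} and x for
-- the others gives weight ω^(sum of T) in A^r. In ω B^r the same monomial gets ω · ω^(sum of the
-- complement), which explains the pattern ω^i - ω^(j+1). The second family exchanges x and x̄ in
-- the factor for R only. The residue of q mod 3 matters through conjugation. If q ≡ 1, it exchanges
-- A and B, so the second term is ω times the conjugate of the first. If q ≡ 2, then Ā = ω² A and
-- likewise for B, so each of them ranges over a single F_q-line and supplies one coordinate. Two
-- obstacles remain. The inverses of `β₁` and `β₂` are meaningful only once these are nonzero, which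
-- rests on S being prime to 3. And X^r P(X^(q-1)) is rewritten as a form in x̄ and x without
-- dividing by x, so that x = 0 needs no separate case.

private
  variable
    a b c ℓ c′ ℓ′ ρ ℓρ m ℓm m′ ℓm′ : Level

-- Prime divisors of factorials, binomial coefficients and powers

module _ where
  open Nat using (_*_; _^_)

  prime∤! : ∀ {p} → Prime p → ∀ n → n < p → p ∤ n !
  prime∤! {p} pp zero    _   p∣ =
    nonTrivial⇒≢1 {{prime⇒nonTrivial pp}} (∣1⇒≡1 p∣)
  prime∤! {p} pp (suc n) n<p p∣ with euclidsLemma (suc n) (n !) pp p∣
  ... | inj₁ p∣1+n = ℕ.<⇒≱ n<p (∣⇒≤ p∣1+n)
  ... | inj₂ p∣n!  = prime∤! pp n (ℕ.<-trans (ℕ.n<1+n n) n<p) p∣n!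

  -- `p !` is the product of `p C k` and `k ! * (p ∸ k) !`, and p divides neither factorial because
  -- all their factors are below p.
  prime∣C : ∀ {p} → Prime p → ∀ k → 0 < k → k < p → p ∣ p C k
  prime∣C {suc n} pp k 0<k k<p
    with euclidsLemma (suc n C k) (k ! * (suc n ∸ k) !) pp p∣C*d
    where
    instance d≢0 = k ℕ.!* (suc n ∸ k) !≢0
    p∣C*d : suc n ∣ (suc n C k) * (k ! * (suc n ∸ k) !)
    p∣C*d = ≡.subst (suc n ∣_)
      (≡.sym (≡.trans (≡.cong (_* (k ! * (suc n ∸ k) !)) (nCk≡n!/k![n-k]! (ℕ.<⇒≤ k<p)))
                      (m/n*n≡m (k![n∸k]!∣n! (ℕ.<⇒≤ k<p)))))
      (m∣m*n (n !))
  ... | inj₁ p∣C = p∣C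
  ... | inj₂ p∣d with euclidsLemma (k !) ((suc n ∸ k) !) pp p∣d
  ...   | inj₁ p∣k!     = contradiction p∣k! (prime∤! pp k k<p)
  ...   | inj₂ p∣[p-k]! = contradiction p∣[p-k]!
          (prime∤! pp (suc n ∸ k) (ℕ.∸-monoʳ-< 0<k (ℕ.<⇒≤ k<p)))

  prime∣^ : ∀ {p} → Prime p → ∀ n i → p ∣ n ^ i → p ∣ n
  prime∣^ pp n zero    p∣1 =
    contradiction (∣1⇒≡1 p∣1) (nonTrivial⇒≢1 {{prime⇒nonTrivial pp}})
  prime∣^ pp n (suc i) p∣  = [ (λ p∣n → p∣n) , prime∣^ pp n i ]′ (euclidsLemma n (n ^ i) pp p∣)

injective⇒surjective-Fin : ∀ {n} (f : Fin n → Fin n) → Injective _≡_ _≡_ f →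
                           ∀ j → ∃[ i ] f i ≡ j
injective⇒surjective-Fin {suc n} f inj j with any? (λ i → f i ≟ᶠ j)
... | yes hit  = hit
... | no  miss = contradiction
  (injective⇒≤ {f = λ i → punchOut {i = j} {j = f i} (λ j≡fi → miss (i , ≡.sym j≡fi))}
    (λ eq → inj (punchOut-injective {i = j} _ _ eq)))
  ℕ.1+n≰n

-- `β₁` and `β₂` branch on `does` of a decision, which forgets the evidence; this hands the proof or
-- the refutation back to each branch.
if-elim : ∀ {A : Set a} {X : Set b} (P : A → Set ℓ) (d : Dec X) {s t : A} →
          (X → P s) → (¬ X → P t) → P (if does d then s else t)
if-elim P (yes x) Ps Pt = Ps x
if-elim P (no ¬x) Ps Pt = Pt ¬x

-- Finite setoids

module _ {A : Setoid a ℓ} {n : ℕ} (card : HasCardinality A n) where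
  open Setoid A
  open Inverse card renaming (to to index; from to element)

  element-index : ∀ x → element (index x) ≈ x
  element-index x = inverseʳ ≡.refl

  index-injective : Injective _≈_ _≡_ index
  index-injective {x} {y} eq =
    trans (sym (element-index x)) (trans (reflexive (≡.cong element eq)) (element-index y))

  finite⇒decidable : Decidable _≈_
  finite⇒decidable x y = map′ index-injective to-cong (index x ≟ᶠ index y)

  module _ {c ℓ″} (M : CommutativeMonoid c ℓ″) where
    private module M = CommutativeMonoid M
    open Sum M using (sum; sum-permute; sum-cong-≋)

    -- Conjugating φ with the enumeration makes it a permutation of `Fin n`. Two instances matter:
    -- translation by `1#` in the additive monoid yields the characteristic, and multiplication by a
    -- nonzero element in the multiplicative monoid yields Fermat's theorem.
    sum-reindex : (f : Carrier → M.Carrier) → Congruent _≈_ M._≈_ f →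
                  (φ ψ : Carrier → Carrier) → Congruent _≈_ _≈_ φ → Congruent _≈_ _≈_ ψ →
                  (∀ x → φ (ψ x) ≈ x) → (∀ x → ψ (φ x) ≈ x) →
                  sum (f ∘ element) M.≈ sum (f ∘ φ ∘ element)
    sum-reindex f f-cong φ ψ φ-cong ψ-cong φψ ψφ =
      M.trans (sum-permute (f ∘ element) π)
              (sum-cong-≋ (λ i → f-cong (element-index (φ (element i)))))
      where
      conj-inverse : (g h : Carrier → Carrier) → Congruent _≈_ _≈_ g → (∀ x → g (h x) ≈ x) →
                     ∀ i → index (g (element (index (h (element i))))) ≡ i
      conj-inverse g h g-cong gh i =
        inverseˡ (trans (g-cong (element-index (h (element i)))) (gh (element i)))

      π : Permutation n n
      π = permutation (index ∘ φ ∘ element) (index ∘ ψ ∘ element)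
            (conj-inverse φ ψ φ-cong φψ) (conj-inverse ψ φ ψ-cong ψφ)

injective⇒surjective : ∀ {A : Setoid a ℓ} {B : Setoid b ℓ′} {n} →
  HasCardinality A n → HasCardinality B n →
  let open Setoid A using () renaming (_≈_ to _≈₁_)
      open Setoid B using () renaming (_≈_ to _≈₂_)
  in (f : Setoid.Carrier A → Setoid.Carrier B) →
     Congruent _≈₁_ _≈₂_ f → Injective _≈₁_ _≈₂_ f → Surjective _≈₁_ _≈₂_ f
injective⇒surjective {A = A} {B = B} cardA cardB f f-cong f-inj y =
  let i , eq = injective⇒surjective-Fin (B.to ∘ f ∘ A.from) index-f-inj (B.to y)
  in A.from i , λ z≈ → Setoid.trans B (f-cong z≈) (index-injective cardB eq)
  where
  module A = Inverse cardA
  module B = Inverse cardB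
  index-f-inj : Injective _≡_ _≡_ (B.to ∘ f ∘ A.from)
  index-f-inj {i} {j} eq =
    ≡.trans (≡.sym (A.inverseˡ (Setoid.refl A)))
      (A.inverseˡ (f-inj (index-injective cardB eq)))

×-cardinality : ∀ {A : Setoid a ℓ} {B : Setoid b ℓ′} {m n} →
  HasCardinality A m → HasCardinality B n → HasCardinality (×-setoid A B) (m Nat.* n)
×-cardinality {A = A} {B = B} {m} {n} cardA cardB = record
  { to        = λ (x , y) → combine (A.to x) (B.to y)
  ; from      = λ i → A.from (proj₁ (remQuot {m} n i)) , B.from (proj₂ (remQuot {m} n i))
  ; to-cong   = λ (x≈ , y≈) → ≡.cong₂ combine (A.to-cong x≈) (B.to-cong y≈)
  ; from-cong = λ { ≡.refl → Setoid.refl A , Setoid.refl B }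
  ; inverse   = (λ {i} (x≈ , y≈) → ≡.trans
                  (≡.cong₂ combine (A.inverseˡ x≈) (B.inverseˡ y≈))
                  (combine-remQuot {m} n i))
              , λ { {x , y} ≡.refl →
                  A.inverseʳ (≡.cong proj₁ (remQuot-combine (A.to x) (B.to y)))
                , B.inverseʳ (≡.cong proj₂ (remQuot-combine (A.to x) (B.to y))) }
  }
  where
  module A = Inverse cardA
  module B = Inverse cardB

-- Linear isomorphisms

module _ {R : CommutativeRing ρ ℓρ} (U : Module R m ℓm) (V : Module R m′ ℓm′) where
  private
    module R = CommutativeRing R
    module U = Module U
    module V = Module V
    module UG = AbelianGroupProperties U.+ᴹ-abelianGroup
    module VG = AbelianGroupProperties V.+ᴹ-abelianGroup

  -- Additivity and left homogeneity suffice: zero is preserved because `0ᴹ` is a `0#`-multiple,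
  -- negatives by uniqueness of inverses, and the right action because it coincides with the left
  -- one.
  bijective-linear⇒iso : (f : U.Carrierᴹ → V.Carrierᴹ) → Congruent U._≈ᴹ_ V._≈ᴹ_ f →
    (∀ x y → f (x U.+ᴹ y) V.≈ᴹ f x V.+ᴹ f y) → (∀ s x → f (s U.*ₗ x) V.≈ᴹ s V.*ₗ f x) →
    Injective U._≈ᴹ_ V._≈ᴹ_ f → Surjective U._≈ᴹ_ V._≈ᴹ_ f →
    IsModuleIsomorphism U.rawModule V.rawModule f
  bijective-linear⇒iso f f-cong f-+ f-* f-inj f-surj = record
    { isModuleMonomorphism = record
      { isModuleHomomorphism = record
        { isBimoduleHomomorphism = record
          { +ᴹ-isGroupHomomorphism = record
            { isMonoidHomomorphism = record
              { isMagmaHomomorphism = record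
                { isRelHomomorphism = record { cong = f-cong }
                ; homo = f-+
                }
              ; ε-homo = f-0
              }
            ; ⁻¹-homo = λ x → VG.inverseˡ-unique (f (U.-ᴹ x)) (f x)
                (V.≈ᴹ-trans (V.≈ᴹ-sym (f-+ (U.-ᴹ x) x))
                  (V.≈ᴹ-trans (f-cong (U.-ᴹ‿inverseˡ x)) f-0))
            }
          ; *ₗ-homo = f-*
          ; *ᵣ-homo = λ s x → V.≈ᴹ-trans (f-cong (U.≈ᴹ-sym (U.*ₗ-*ᵣ-coincident s x)))
              (V.≈ᴹ-trans (f-* s x) (V.*ₗ-*ᵣ-coincident s (f x)))
          }
        }
      ; injective = f-inj
      }
    ; surjective = f-surj
    }
    where
    f-0 : f U.0ᴹ V.≈ᴹ V.0ᴹ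
    f-0 = V.≈ᴹ-trans (f-cong (U.≈ᴹ-sym (U.*ₗ-zeroˡ U.0ᴹ)))
            (V.≈ᴹ-trans (f-* R.0# U.0ᴹ) (V.*ₗ-zeroˡ (f U.0ᴹ)))

  finite-linear⇒iso : ∀ {n} → HasCardinality U.≈ᴹ-setoid n → HasCardinality V.≈ᴹ-setoid n →
    (f : U.Carrierᴹ → V.Carrierᴹ) → Congruent U._≈ᴹ_ V._≈ᴹ_ f →
    (∀ x y → f (x U.+ᴹ y) V.≈ᴹ f x V.+ᴹ f y) → (∀ s x → f (s U.*ₗ x) V.≈ᴹ s V.*ₗ f x) →
    (∀ x → f x V.≈ᴹ V.0ᴹ → x U.≈ᴹ U.0ᴹ) →
    IsModuleIsomorphism U.rawModule V.rawModule f
  finite-linear⇒iso cardU cardV f f-cong f-+ f-* f-kernel =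
    bijective-linear⇒iso f f-cong f-+ f-* f-inj (injective⇒surjective cardU cardV f f-cong f-inj)
    where
    f-inj : Injective U._≈ᴹ_ V._≈ᴹ_ f
    f-inj {x} {y} fx≈fy = UG.x∙y⁻¹≈ε⇒x≈y x y (f-kernel (x U.+ᴹ (U.-ᴹ y)) (begin
      f (x U.+ᴹ U.-ᴹ y)          ≈⟨ f-+ x (U.-ᴹ y) ⟩
      f x V.+ᴹ f (U.-ᴹ y)        ≈⟨ V.+ᴹ-congʳ fx≈fy ⟩
      f y V.+ᴹ f (U.-ᴹ y)        ≈⟨ f-+ y (U.-ᴹ y) ⟨
      f (y U.+ᴹ U.-ᴹ y)          ≈⟨ f-cong (U.-ᴹ‿inverseʳ y) ⟩
      f U.0ᴹ                     ≈⟨ f-cong (U.≈ᴹ-sym (U.*ₗ-zeroˡ U.0ᴹ)) ⟩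
      f (R.0# U.*ₗ U.0ᴹ)         ≈⟨ f-* R.0# U.0ᴹ ⟩
      R.0# V.*ₗ f U.0ᴹ           ≈⟨ V.*ₗ-zeroˡ (f U.0ᴹ) ⟩
      V.0ᴹ                       ∎))
      where open SetoidReasoning V.≈ᴹ-setoid

  module _ {f : U.Carrierᴹ → V.Carrierᴹ} (iso : IsModuleIsomorphism U.rawModule V.rawModule f) where
    private module f = IsModuleIsomorphism iso

    inverse : V.Carrierᴹ → U.Carrierᴹ
    inverse y = proj₁ (f.surjective y)

    f-inverse : ∀ y → f (inverse y) V.≈ᴹ y
    f-inverse y = proj₂ (f.surjective y) U.≈ᴹ-refl

module _ {R : CommutativeRing ρ ℓρ} (U : Module R m ℓm) (V : Module R m′ ℓm′) where
  private
    module U = Module U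
    module V = Module V

  -- Each law of the inverse is checked after applying the injective `f`, where it turns into a law
  -- of `f`.
  inverse-iso : ∀ {f} (iso : IsModuleIsomorphism U.rawModule V.rawModule f) →
                IsModuleIsomorphism V.rawModule U.rawModule (inverse U V iso)
  inverse-iso {f} iso = bijective-linear⇒iso V U g
    (λ {x} {y} x≈y → f.injective (V.≈ᴹ-trans (fg x) (V.≈ᴹ-trans x≈y (V.≈ᴹ-sym (fg y)))))
    (λ x y → f.injective (V.≈ᴹ-trans (fg _) (V.≈ᴹ-sym
      (V.≈ᴹ-trans (f.+ᴹ-homo (g x) (g y)) (V.+ᴹ-cong (fg x) (fg y))))))
    (λ s x → f.injective (V.≈ᴹ-trans (fg _) (V.≈ᴹ-sym
      (V.≈ᴹ-trans (f.*ₗ-homo s (g x)) (V.*ₗ-congˡ (fg x))))))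
    (λ {x} {y} gx≈gy → V.≈ᴹ-trans (V.≈ᴹ-sym (fg x)) (V.≈ᴹ-trans (f.⟦⟧-cong gx≈gy) (fg y)))
    (λ x → f x , λ y≈fx → f.injective (V.≈ᴹ-trans (fg _) y≈fx))
    where
    module f = IsModuleIsomorphism iso
    g = inverse U V iso
    fg = f-inverse U V iso

  -- Meant for φ the conjugation x ↦ x̄, which carries the case z = 1 to z = 2.
  precompose-iso : ∀ {φ} f f′ g → IsModuleIsomorphism U.rawModule U.rawModule φ →
    (∀ u → f′ u U.≈ᴹ f (φ u)) → LinearlyEquivalent U V f g → LinearlyEquivalent U V f′ g
  precompose-iso {φ} f f′ g φ-iso f′≈fφ (ρ , η , ρ-iso , η-iso , f≈ρgη) =
    ρ , (λ u → η (φ u)) , ρ-iso , ηφ-iso , λ u → U.≈ᴹ-trans (f′≈fφ u) (f≈ρgη (φ u))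
    where
    module φ = IsModuleIsomorphism φ-iso
    module η = IsModuleIsomorphism η-iso
    ηφ-iso = bijective-linear⇒iso U V (λ u → η (φ u))
      (λ u≈v → η.⟦⟧-cong (φ.⟦⟧-cong u≈v))
      (λ u v → V.≈ᴹ-trans (η.⟦⟧-cong (φ.+ᴹ-homo u v)) (η.+ᴹ-homo (φ u) (φ v)))
      (λ s u → V.≈ᴹ-trans (η.⟦⟧-cong (φ.*ₗ-homo s u)) (η.*ₗ-homo s (φ u)))
      (λ eq → φ.injective (η.injective eq))
      (λ w → let v , ηv = η.surjective w ; u , φu = φ.surjective v
             in u , λ z≈u → ηv (φu z≈u))

-- Frobenius and finite fields

module _ (R : CommutativeSemiring c ℓ) where
  open CommutativeSemiring R hiding (zero)
  open SemiringExp semiring using (_^_; ^-congˡ; ^-assocʳ)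
  open SemiringMult semiring using () renaming
    (_×_ to _·_; ×-congˡ to ·-congˡ; ×-congʳ to ·-congʳ; ×-assocˡ to ·-assocˡ; ×-assoc-* to ·-assoc-*; ×-homo-1 to ·-homo-1)
  open Sum +-commutativeMonoid using (sum; sum-init-last; sum-cong-≋; sum-replicate-zero)
  open Binomial R using (binomialTerm) renaming (theorem to binomial-theorem)
  open SetoidReasoning setoid

  -- Over a semiring, `p · 1# ≈ 0#` expresses characteristic p. It kills every binomial term except
  -- the two outer ones, whose coefficients are 1.
  freshman's-dream : ∀ {p} → Prime p → p · 1# ≈ 0# → ∀ x y → (x + y) ^ p ≈ x ^ p + y ^ p
  freshman's-dream {suc p} p-prime p·1≈0 x y = begin
    (x + y) ^ suc p                          ≈⟨ binomial-theorem (suc p) x y ⟩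
    t zero + sum (t ∘ suc)                   ≈⟨ +-congˡ (sum-init-last (t ∘ suc)) ⟩
    t zero + (sum inner + t (fromℕ (suc p))) ≈⟨ +-cong first (+-cong inner≈0 last) ⟩
    y ^ suc p + (0# + x ^ suc p)             ≈⟨ +-congˡ (+-identityˡ _) ⟩
    y ^ suc p + x ^ suc p                    ≈⟨ +-comm _ _ ⟩
    x ^ suc p + y ^ suc p                    ∎
    where
    t = binomialTerm x y (suc p)
    inner : Fin p → Carrier
    inner i = t (suc (inject₁ i))

    first : t zero ≈ y ^ suc p
    first = trans (·-homo-1 _) (*-identityˡ _)

    last : t (fromℕ (suc p)) ≈ x ^ suc p
    last = begin
      (suc p C toℕ (fromℕ (suc p))) · (x ^ toℕ (fromℕ (suc p)) * y ^ (suc p ∸ toℕ (fromℕ (suc p))))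
        ≡⟨ ≡.cong (λ k → (suc p C k) · (x ^ k * y ^ (suc p ∸ k))) (toℕ-fromℕ (suc p)) ⟩
      (suc p C suc p) · (x ^ suc p * y ^ (p ∸ p))
        ≡⟨ ≡.cong₂ (λ k l → k · (x ^ suc p * y ^ l)) (nCn≡1 (suc p)) (ℕ.n∸n≡0 p) ⟩
      1 · (x ^ suc p * 1#)  ≈⟨ ·-homo-1 _ ⟩
      x ^ suc p * 1#        ≈⟨ *-identityʳ _ ⟩
      x ^ suc p             ∎

    p·≈0 : ∀ z → suc p · z ≈ 0#
    p·≈0 z = begin
      suc p · z          ≈⟨ ·-congʳ (suc p) (*-identityˡ z) ⟨
      suc p · (1# * z)   ≈⟨ ·-assoc-* (suc p) 1# z ⟨
      (suc p · 1#) * z   ≈⟨ *-congʳ p·1≈0 ⟩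
      0# * z             ≈⟨ zeroˡ z ⟩
      0#                 ∎

    p∣⇒·≈0 : ∀ {n} → suc p ∣ n → ∀ z → n · z ≈ 0#
    p∣⇒·≈0 (divides q n≡qp) z = trans
      (·-congˡ (≡.trans n≡qp (ℕ.*-comm q (suc p))))
      (trans (sym (·-assocˡ z (suc p) q)) (p·≈0 (q · z)))

    inner≈0 : sum inner ≈ 0#
    inner≈0 = trans
      (sum-cong-≋ (λ i → p∣⇒·≈0 (prime∣C p-prime (suc (toℕ (inject₁ i))) (s≤s z≤n)
        (s≤s (≡.subst (_< p) (≡.sym (toℕ-inject₁ i)) (toℕ<n i)))) _))
      (sum-replicate-zero p)

  ^-homo-+-primePower : ∀ {p} → Prime p → p · 1# ≈ 0# → ∀ i x y →
                        (x + y) ^ (p Nat.^ i) ≈ x ^ (p Nat.^ i) + y ^ (p Nat.^ i)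
  ^-homo-+-primePower p-prime p·1≈0 zero x y =
    trans (*-identityʳ _) (sym (+-cong (*-identityʳ x) (*-identityʳ y)))
  ^-homo-+-primePower {p} p-prime p·1≈0 (suc i) x y = begin
    (x + y) ^ (p Nat.* p^i)            ≈⟨ ^-assocʳ (x + y) p p^i ⟨
    ((x + y) ^ p) ^ p^i                ≈⟨ ^-congˡ p^i (freshman's-dream p-prime p·1≈0 x y) ⟩
    (x ^ p + y ^ p) ^ p^i              ≈⟨ ^-homo-+-primePower p-prime p·1≈0 i (x ^ p) (y ^ p) ⟩
    (x ^ p) ^ p^i + (y ^ p) ^ p^i      ≈⟨ +-cong (^-assocʳ x p p^i) (^-assocʳ y p p^i) ⟩
    x ^ (p Nat.* p^i) + y ^ (p Nat.* p^i) ∎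
    where p^i = p Nat.^ i

module FieldProperties (K : Field c ℓ) where
  open Field K hiding (zero)
  open SetoidReasoning setoid

  *-cancelˡ : ∀ x {y z} → x ≉ 0# → x * y ≈ x * z → y ≈ z
  *-cancelˡ x {y} {z} x≉0 xy≈xz = begin
    y               ≈⟨ unit y ⟨
    x ⁻¹ * (x * y)  ≈⟨ *-congˡ xy≈xz ⟩
    x ⁻¹ * (x * z)  ≈⟨ unit z ⟩
    z               ∎
    where
    unit : ∀ y → x ⁻¹ * (x * y) ≈ y
    unit y = begin
      x ⁻¹ * (x * y)  ≈⟨ *-assoc (x ⁻¹) x y ⟨
      (x ⁻¹ * x) * y  ≈⟨ *-congʳ (trans (*-comm (x ⁻¹) x) (*-inverse x x≉0)) ⟩
      1# * y          ≈⟨ *-identityˡ y ⟩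
      y               ∎

  xy≈0⇒y≈0 : ∀ {x y} → x ≉ 0# → x * y ≈ 0# → y ≈ 0#
  xy≈0⇒y≈0 {x} x≉0 xy≈0 = *-cancelˡ x x≉0 (trans xy≈0 (sym (zeroʳ x)))

  x≉0∧y≉0⇒xy≉0 : ∀ {x y} → x ≉ 0# → y ≉ 0# → x * y ≉ 0#
  x≉0∧y≉0⇒xy≉0 x≉0 y≉0 xy≈0 = y≉0 (xy≈0⇒y≈0 x≉0 xy≈0)

  x≉0⇒x^n≉0 : ∀ {x} → x ≉ 0# → ∀ n → x ^ n ≉ 0#
  x≉0⇒x^n≉0 x≉0 zero    1≈0 = 0≉1 (sym 1≈0)
  x≉0⇒x^n≉0 x≉0 (suc n)     = x≉0∧y≉0⇒xy≉0 x≉0 (x≉0⇒x^n≉0 x≉0 n)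

  x≉0⇒x⁻¹≉0 : ∀ {x} → x ≉ 0# → x ⁻¹ ≉ 0#
  x≉0⇒x⁻¹≉0 {x} x≉0 x⁻¹≈0 =
    0≉1 (trans (sym (zeroʳ x)) (trans (*-congˡ (sym x⁻¹≈0)) (*-inverse x x≉0)))

module FiniteField (K : Field c ℓ) {n : ℕ} (card : HasCardinality (Field.setoid K) n) where
  open Field K hiding (zero)
  open FieldProperties K
  open SemiringMult semiring using () renaming (_×_ to _·_; ×1-homo-* to ·1-homo-*; ×-homo-1 to ·-homo-1)
  open Inverse card using () renaming (from to element)
  open SetoidReasoning setoid
  private module +G = GroupProperties +-group

  infix 4 _≟_
  _≟_ : ∀ x y → Dec (x ≈ y)
  _≟_ = finite⇒decidable card

  -- Translation by `1#` permutes the field, so the sum of all elements equals itself plus n times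
  -- `1#`.
  cardinality·1≈0 : n · 1# ≈ 0#
  cardinality·1≈0 = +G.∙-cancelʳ (sum element) (n · 1#) 0# (begin
    n · 1# + sum element                 ≈⟨ +-congʳ (sum-replicate n) ⟨
    sum (replicate n 1#) + sum element   ≈⟨ ∑-distrib-+ (replicate n 1#) element ⟨
    sum (λ i → 1# + element i)           ≈⟨ sum-reindex card +-commutativeMonoid id id
                                              (1# +_) (- 1# +_) +-congˡ +-congˡ
                                              (cancel (-‿inverseʳ 1#)) (cancel (-‿inverseˡ 1#)) ⟨
    sum element                          ≈⟨ +-identityˡ _ ⟨
    0# + sum element                     ∎)
    where
    open Sum +-commutativeMonoid using (sum; sum-replicate; ∑-distrib-+)
    cancel : ∀ {x y} → x + y ≈ 0# → ∀ z → x + (y + z) ≈ z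
    cancel x+y≈0 z = trans (sym (+-assoc _ _ z)) (trans (+-congʳ x+y≈0) (+-identityˡ z))

  -- The k-th power of p · 1 is n · 1 = 0, and a field has no nonzero nilpotent element.
  p·1≈0 : ∀ p k → n ≡ p Nat.^ k → p · 1# ≈ 0#
  p·1≈0 p k n≡p^k with p · 1# ≟ 0#
  ... | yes p≈0 = p≈0
  ... | no  p≉0 = contradiction
    (trans (sym (^-homo k)) (trans (reflexive (≡.cong (_· 1#) (≡.sym n≡p^k))) cardinality·1≈0))
    (x≉0⇒x^n≉0 p≉0 k)
    where
    ^-homo : ∀ k → (p Nat.^ k) · 1# ≈ (p · 1#) ^ k
    ^-homo zero    = ·-homo-1 1#
    ^-homo (suc k) = trans (·1-homo-* p (p Nat.^ k)) (*-congˡ (^-homo k))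

module _ (K : Field c ℓ) {m : ℕ} (card : HasCardinality (Field.setoid K) (suc m)) where
  open Field K hiding (zero)
  open FieldProperties K
  open FiniteField K card using (_≟_)
  open Inverse card using () renaming (from to element; to to index)
  open SetoidReasoning setoid

  -- Multiplication by x ≉ 0 permutes the field, hence preserves the product of all nonzero
  -- elements; the factor 1 stands in for the element 0.
  x^[cardinality-1]≈1 : ∀ {x} → x ≉ 0# → x ^ m ≈ 1#
  x^[cardinality-1]≈1 {x} x≉0 = x^m≈1
    where
    open Sum *-commutativeMonoid using () renaming
      (sum to product; sum-replicate to product-replicate; sum-remove to product-remove;
       ∑-distrib-+ to product-distrib; sum-cong-≋ to product-cong)

    unlessZero : Carrier → Carrier → Carrier
    unlessZero z y with z ≟ 0#
    ... | yes _ = 1#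
    ... | no  _ = y

    unlessZero-zero : ∀ {z} y → z ≈ 0# → unlessZero z y ≈ 1#
    unlessZero-zero {z} y z≈0 with z ≟ 0#
    ... | yes _   = refl
    ... | no  z≉0 = contradiction z≈0 z≉0

    unlessZero-nonzero : ∀ {z} y → z ≉ 0# → unlessZero z y ≈ y
    unlessZero-nonzero {z} y z≉0 with z ≟ 0#
    ... | yes z≈0 = contradiction z≈0 z≉0
    ... | no  _   = refl

    nz : Carrier → Carrier
    nz z = unlessZero z z

    nz-cong : ∀ {y z} → y ≈ z → nz y ≈ nz z
    nz-cong {y} {z} y≈z = cases (y ≟ 0#)
      where
      cases : Dec (y ≈ 0#) → nz y ≈ nz z
      cases (yes y≈0) = trans (unlessZero-zero y y≈0) (sym (unlessZero-zero z (trans (sym y≈z) y≈0)))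
      cases (no  y≉0) = trans (unlessZero-nonzero y y≉0)
        (trans y≈z (sym (unlessZero-nonzero z (λ z≈0 → y≉0 (trans y≈z z≈0)))))

    nz≉0 : ∀ z → nz z ≉ 0#
    nz≉0 z with z ≟ 0#
    ... | yes _   = λ 1≈0 → 0≉1 (sym 1≈0)
    ... | no  z≉0 = z≉0

    -- Multiplication by x scales every factor of the product except the one standing for 0, where
    -- both sides are 1.
    nz-* : ∀ z → nz (x * z) ≈ unlessZero z x * nz z
    nz-* z = cases (z ≟ 0#)
      where
      cases : Dec (z ≈ 0#) → nz (x * z) ≈ unlessZero z x * nz z
      cases (yes z≈0) = trans (unlessZero-zero _ (trans (*-congˡ z≈0) (zeroʳ x)))
        (sym (trans (*-cong (unlessZero-zero x z≈0) (unlessZero-zero z z≈0)) (*-identityˡ 1#)))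
      cases (no  z≉0) = trans (unlessZero-nonzero _ (x≉0∧y≉0⇒xy≉0 x≉0 z≉0))
        (sym (*-cong (unlessZero-nonzero x z≉0) (unlessZero-nonzero z z≉0)))

    product≉0 : ∀ {k} (t : Fin k → Carrier) → (∀ i → t i ≉ 0#) → product t ≉ 0#
    product≉0 {zero}  t t≉0 = λ 1≈0 → 0≉1 (sym 1≈0)
    product≉0 {suc k} t t≉0 = x≉0∧y≉0⇒xy≉0 (t≉0 zero) (product≉0 (t ∘ suc) (t≉0 ∘ suc))

    factors : Fin (suc m) → Carrier
    factors i = unlessZero (element i) x

    product-factors≈1 : product factors ≈ 1#
    product-factors≈1 = *-cancelˡ (product (nz ∘ element))
      (product≉0 (nz ∘ element) (nz≉0 ∘ element)) (begin
        product (nz ∘ element) * product factors            ≈⟨ *-comm _ _ ⟩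
        product factors * product (nz ∘ element)            ≈⟨ product-distrib factors (nz ∘ element) ⟨
        product (λ i → factors i * nz (element i))          ≈⟨ product-cong (nz-* ∘ element) ⟨
        product (λ i → nz (x * element i))                  ≈⟨ sum-reindex card *-commutativeMonoid nz nz-cong
                                                                  (x *_) (x ⁻¹ *_) *-congˡ *-congˡ
                                                                  (cancel (*-inverse x x≉0))
                                                                  (cancel (trans (*-comm _ _) (*-inverse x x≉0))) ⟨
        product (nz ∘ element)                              ≈⟨ *-identityʳ _ ⟨
        product (nz ∘ element) * 1#                         ∎)
      where
      cancel : ∀ {y z} → y * z ≈ 1# → ∀ w → y * (z * w) ≈ w
      cancel yz≈1 w = trans (sym (*-assoc _ _ w)) (trans (*-congʳ yz≈1) (*-identityˡ w))

    i₀ : Fin (suc m)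
    i₀ = index 0#

    x^m≈1 : x ^ m ≈ 1#
    x^m≈1 = begin
      x ^ m                                              ≈⟨ product-replicate m ⟨
      -- The exponent m arises here: of the `suc m` factors, the one at the index of 0 is 1 and the
      -- remaining m are x.
      product (replicate m x)                            ≈⟨ product-cong (λ j → sym (unlessZero-nonzero x (others≉0 j))) ⟩
      product (λ j → factors (punchIn i₀ j))             ≈⟨ *-identityˡ _ ⟨
      1# * product (λ j → factors (punchIn i₀ j))        ≈⟨ *-congʳ (unlessZero-zero x (element-index card 0#)) ⟨
      factors i₀ * product (λ j → factors (punchIn i₀ j)) ≈⟨ product-remove factors ⟨
      product factors                                    ≈⟨ product-factors≈1 ⟩
      1#                                                 ∎
      where
      others≉0 : ∀ j → element (punchIn i₀ j) ≉ 0#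
      others≉0 j e≈0 = punchInᵢ≢i i₀ j
        (≡.sym (Inverse.inverseˡ card (sym e≈0)))

x^cardinality≈x : ∀ (K : Field c ℓ) {n} → HasCardinality (Field.setoid K) n →
                  let open Field K in ∀ x → x ^ n ≈ x
x^cardinality≈x K {zero}  card x = contradiction (Inverse.to card x) λ()
x^cardinality≈x K {suc m} card x with FiniteField._≟_ K card x (Field.0# K)
... | yes x≈0 = trans (^-congˡ (suc m) x≈0) (trans (zeroˡ _) (sym x≈0))
  where
  open Field K
  open SemiringExp semiring using (^-congˡ)
... | no  x≉0 = trans (*-congˡ (x^[cardinality-1]≈1 K card x≉0)) (*-identityʳ x)
  where open Field K

-- The two families of polynomials

module _ (R : CommutativeSemiring c ℓ) where
  open CommutativeSemiring R
  open SemiringSolver R using (solve; _:=_; _:+_; _:*_; con)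

  -- κ stands for − ω, which turns the expansions into semiring identities.
  expansion₁ : ∀ κ u v w y₁ y₂ y₃ x₁ x₂ x₃ →
    (u * v * w + κ * 1#) * (y₁ * y₂ * y₃ * 1#)
    + ((u * v + κ * w) * (y₁ * y₂ * x₃)
    + ((u * w + κ * v) * (y₁ * y₃ * x₂)
    + ((v * w + κ * u) * (y₂ * y₃ * x₁)
    + ((u + κ * (v * w)) * (y₁ * (x₂ * x₃))
    + ((v + κ * (u * w)) * (y₂ * (x₁ * x₃))
    + ((w + κ * (u * v)) * (y₃ * (x₁ * x₂))
    + ((1# + κ * (u * v * w)) * (1# * (x₁ * x₂ * x₃)) + 0#)))))))
    ≈ (x₁ + u * y₁) * (x₂ + v * y₂) * (x₃ + w * y₃)
      + κ * ((y₁ + u * x₁) * (y₂ + v * x₂) * (y₃ + w * x₃))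
  expansion₁ = solve 10 (λ κ u v w y₁ y₂ y₃ x₁ x₂ x₃ →
    (u :* v :* w :+ κ :* con 1) :* (y₁ :* y₂ :* y₃ :* con 1)
    :+ ((u :* v :+ κ :* w) :* (y₁ :* y₂ :* x₃)
    :+ ((u :* w :+ κ :* v) :* (y₁ :* y₃ :* x₂)
    :+ ((v :* w :+ κ :* u) :* (y₂ :* y₃ :* x₁)
    :+ ((u :+ κ :* (v :* w)) :* (y₁ :* (x₂ :* x₃))
    :+ ((v :+ κ :* (u :* w)) :* (y₂ :* (x₁ :* x₃))
    :+ ((w :+ κ :* (u :* v)) :* (y₃ :* (x₁ :* x₂))
    :+ ((con 1 :+ κ :* (u :* v :* w)) :* (con 1 :* (x₁ :* x₂ :* x₃)) :+ con 0)))))))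
    := (x₁ :+ u :* y₁) :* (x₂ :+ v :* y₂) :* (x₃ :+ w :* y₃)
       :+ κ :* ((y₁ :+ u :* x₁) :* (y₂ :+ v :* x₂) :* (y₃ :+ w :* x₃))) refl

  -- This is `expansion₁` with `x₂` and `y₂` exchanged and the summands reordered, since the second
  -- family arises from the first by adding R to an exponent that lacks it and removing it
  -- otherwise. The stray `1#` and `0#` are what zero exponents and the empty list leave behind in
  -- `homogeneous`.
  expansion₂ : ∀ κ u v w y₁ y₂ y₃ x₁ x₂ x₃ →
    (u * w + κ * v) * (y₁ * y₂ * y₃ * 1#)
    + ((u + κ * (v * w)) * (y₁ * y₂ * x₃)
    + ((u * v * w + κ * 1#) * (y₁ * y₃ * x₂)
    + ((w + κ * (u * v)) * (y₂ * y₃ * x₁)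
    + ((u * v + κ * w) * (y₁ * (x₂ * x₃))
    + ((1# + κ * (u * v * w)) * (y₂ * (x₁ * x₃))
    + ((v * w + κ * u) * (y₃ * (x₁ * x₂))
    + ((v + κ * (u * w)) * (1# * (x₁ * x₂ * x₃)) + 0#)))))))
    ≈ (x₁ + u * y₁) * (x₃ + w * y₃) * (y₂ + v * x₂)
      + κ * ((y₁ + u * x₁) * (y₃ + w * x₃) * (x₂ + v * y₂))
  expansion₂ = solve 10 (λ κ u v w y₁ y₂ y₃ x₁ x₂ x₃ →
    (u :* w :+ κ :* v) :* (y₁ :* y₂ :* y₃ :* con 1)
    :+ ((u :+ κ :* (v :* w)) :* (y₁ :* y₂ :* x₃)
    :+ ((u :* v :* w :+ κ :* con 1) :* (y₁ :* y₃ :* x₂)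
    :+ ((w :+ κ :* (u :* v)) :* (y₂ :* y₃ :* x₁)
    :+ ((u :* v :+ κ :* w) :* (y₁ :* (x₂ :* x₃))
    :+ ((con 1 :+ κ :* (u :* v :* w)) :* (y₂ :* (x₁ :* x₃))
    :+ ((v :* w :+ κ :* u) :* (y₃ :* (x₁ :* x₂))
    :+ ((v :+ κ :* (u :* w)) :* (con 1 :* (x₁ :* x₂ :* x₃)) :+ con 0)))))))
    := (x₁ :+ u :* y₁) :* (x₃ :+ w :* y₃) :* (y₂ :+ v :* x₂)
       :+ κ :* ((y₁ :+ u :* x₁) :* (y₃ :+ w :* x₃) :* (x₂ :+ v :* y₂))) refl

module Homogenization (K : Field c ℓ) where
  open Field K hiding (zero)
  open Polynomial K
  open SemiringExp semiring using (^-congˡ; ^-homo-*)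
  open CommutativeExp commutativeSemiring using (^-distrib-*)
  open SemiringSolver commutativeSemiring using (solve; _:=_; _:+_; _:*_)
  open SetoidReasoning setoid

  -- x^d P(y / x), provided all exponents occurring in P are at most d.
  homogeneous : ℕ → Poly → Carrier → Carrier → Carrier
  homogeneous d []            y x = 0#
  homogeneous d ((a , e) ∷ P) y x = a * (y ^ e * x ^ (d ∸ e)) + homogeneous d P y x

  HasDegree≤ : ℕ → Poly → Set c
  HasDegree≤ d = All (λ (a , e) → e ≤ d)

  homogeneous-cong : ∀ d P {y y′ x x′} → y ≈ y′ → x ≈ x′ →
                     homogeneous d P y x ≈ homogeneous d P y′ x′
  homogeneous-cong d []            y≈ x≈ = refl
  homogeneous-cong d ((a , e) ∷ P) y≈ x≈ =
    +-cong (*-congˡ (*-cong (^-congˡ e y≈) (^-congˡ (d ∸ e) x≈))) (homogeneous-cong d P y≈ x≈)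

  -- The degree bound makes e ↦ d ∸ e an involution, so each monomial merely has its two powers
  -- swapped.
  homogeneous-reciprocal : ∀ d {P} → HasDegree≤ d P → ∀ y x →
    homogeneous d (reciprocal d P) y x ≈ homogeneous d P x y
  homogeneous-reciprocal d []                            y x = refl
  homogeneous-reciprocal d (_∷_ {x = a , e} {xs = P} e≤d P≤d) y x = +-cong
    (*-congˡ (trans (*-comm _ _)
      (*-congʳ (reflexive (≡.cong (x ^_) (ℕ.m∸[m∸n]≡n e≤d))))))
    (homogeneous-reciprocal d P≤d y x)

  reciprocal-degree : ∀ d P → HasDegree≤ d (reciprocal d P)
  reciprocal-degree d []            = []
  reciprocal-degree d ((a , e) ∷ P) = ℕ.m∸n≤m d e ∷ reciprocal-degree d P

  -- Split x^d into x^e and x^(d-e); the first part completes (x^(q-1))^e to (x^q)^e. No division by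
  -- x occurs, and `1 ≤ q` makes the subtraction in `q ∸ 1` exact.
  x^d*x^[q-1]e : ∀ {q d e} → 1 ≤ q → e ≤ d → ∀ x →
                 x ^ d * (x ^ (q ∸ 1)) ^ e ≈ (x ^ q) ^ e * x ^ (d ∸ e)
  x^d*x^[q-1]e {suc q} {d} {e} _ e≤d x = begin
    x ^ d * (x ^ q) ^ e                ≡⟨ ≡.cong (λ k → x ^ k * (x ^ q) ^ e) (ℕ.m+[n∸m]≡n e≤d) ⟨
    x ^ (e Nat.+ (d ∸ e)) * (x ^ q) ^ e  ≈⟨ *-congʳ (^-homo-* x e (d ∸ e)) ⟩
    x ^ e * x ^ (d ∸ e) * (x ^ q) ^ e  ≈⟨ solve 3 (λ a b c → a :* b :* c := a :* c :* b) refl _ _ _ ⟩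
    x ^ e * (x ^ q) ^ e * x ^ (d ∸ e)  ≈⟨ *-congʳ (^-distrib-* x (x ^ q) e) ⟨
    (x * x ^ q) ^ e * x ^ (d ∸ e)      ∎

  eval-homogeneous : ∀ {q d} → 1 ≤ q → ∀ {P} → HasDegree≤ d P → ∀ b x →
    x ^ d * eval (scale b P) (x ^ (q ∸ 1)) ≈ b * homogeneous d P (x ^ q) x
  eval-homogeneous 1≤q []  b x = trans (zeroʳ _) (sym (zeroʳ b))
  eval-homogeneous {q} {d} 1≤q (_∷_ {x = a , e} {xs = P} e≤d P≤d) b x = begin
    x ^ d * (b * a * t ^ e + eval (scale b P) t)
      ≈⟨ solve 5 (λ X b a T s → X :* (b :* a :* T :+ s) := b :* (a :* (X :* T)) :+ X :* s) refl _ _ _ _ _ ⟩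
    b * (a * (x ^ d * t ^ e)) + x ^ d * eval (scale b P) t
      ≈⟨ +-cong (*-congˡ (*-congˡ (x^d*x^[q-1]e 1≤q e≤d x))) (eval-homogeneous 1≤q P≤d b x) ⟩
    b * (a * ((x ^ q) ^ e * x ^ (d ∸ e))) + b * homogeneous d P (x ^ q) x
      ≈⟨ distribˡ b _ _ ⟨
    b * (a * ((x ^ q) ^ e * x ^ (d ∸ e)) + homogeneous d P (x ^ q) x) ∎
    where t = x ^ (q ∸ 1)

module Factorisation (K : Field c ℓ) (ω : Field.Carrier K) (Q R S : ℕ) where
  open Field K hiding (zero; _+_)
  open Field K using () renaming (_+_ to _⊕_)
  open Nat using (_+_)
  open Families K ω Q R S
  open Homogenization K
  open SemiringExp semiring using (^-homo-*)
  open CommutativeExp commutativeSemiring using (^-distrib-*)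
  open RingProperties ring using (-‿distribˡ-*)
  open SetoidReasoning setoid

  r : ℕ
  r = Q + R + S

  private
    κ = - ω
    S≤r : S ≤ r
    S≤r = ℕ.m≤n+m S (Q + R)
    Q+R≤r : Q + R ≤ r
    Q+R≤r = ℕ.m≤m+n (Q + R) S
    Q≤r : Q ≤ r
    Q≤r = ℕ.≤-trans (ℕ.m≤m+n Q R) Q+R≤r
    R≤r : R ≤ r
    R≤r = ℕ.≤-trans (ℕ.m≤n+m R Q) Q+R≤r
    [Q+S]+R≡r : ∀ Q R S → Q + S + R ≡ Q + R + S
    [Q+S]+R≡r = solve-∀
    [R+S]+Q≡r : ∀ Q R S → R + S + Q ≡ Q + R + S
    [R+S]+Q≡r = solve-∀
    Q+[R+S]≡r : ∀ Q R S → Q + (R + S) ≡ Q + R + S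
    Q+[R+S]≡r = solve-∀
    R+[Q+S]≡r : ∀ Q R S → R + (Q + S) ≡ Q + R + S
    R+[Q+S]≡r = solve-∀
    S+[Q+R]≡r : ∀ Q R S → S + (Q + R) ≡ Q + R + S
    S+[Q+R]≡r = solve-∀
    Q+S≤r : Q + S ≤ r
    Q+S≤r = ≡.subst (Q + S ≤_) ([Q+S]+R≡r Q R S) (ℕ.m≤m+n (Q + S) R)
    R+S≤r : R + S ≤ r
    R+S≤r = ≡.subst (R + S ≤_) ([R+S]+Q≡r Q R S) (ℕ.m≤m+n (R + S) Q)

  C₁⁽¹⁾-degree : HasDegree≤ r C₁⁽¹⁾
  C₁⁽¹⁾-degree = ℕ.≤-refl ∷ Q+R≤r ∷ Q+S≤r ∷ R+S≤r ∷ Q≤r ∷ R≤r ∷ S≤r ∷ z≤n ∷ []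

  C₁⁽²⁾-degree : HasDegree≤ r C₁⁽²⁾
  C₁⁽²⁾-degree = ℕ.≤-refl ∷ Q+R≤r ∷ Q+S≤r ∷ R+S≤r ∷ Q≤r ∷ R≤r ∷ S≤r ∷ z≤n ∷ []

  ^-homo₃ : ∀ x → x ^ r ≈ x ^ Q * x ^ R * x ^ S
  ^-homo₃ x = trans (^-homo-* x (Q + R) S) (*-congʳ (^-homo-* x Q R))

  private
    -- The additional 1 in the subtracted exponent is the factor ω contained in `κ`.
    coefficient : ∀ b {a a′ b′} → a ≈ a′ → ω ^ b ≈ b′ → a - ω ^ (b + 1) ≈ a′ ⊕ κ * b′
    coefficient b {b′ = b′} a≈a′ ω^b≈b′ = +-cong a≈a′ (begin
      - (ω ^ (b + 1))   ≈⟨ -‿cong (^-homo-* ω b 1) ⟩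
      - (ω ^ b * ω ^ 1) ≈⟨ -‿cong (*-cong ω^b≈b′ (*-identityʳ ω)) ⟩
      - (b′ * ω)        ≈⟨ -‿cong (*-comm b′ ω) ⟩
      - (ω * b′)        ≈⟨ -‿distribˡ-* ω b′ ⟩
      κ * b′            ∎)

    -- The case of an empty complement, whose subtracted term is written `ω` and not as a power with
    -- exponent 0 + 1.
    leading : ∀ {a a′} → a ≈ a′ → a - ω ≈ a′ ⊕ κ * 1#
    leading a≈a′ = +-cong a≈a′ (sym (*-identityʳ κ))

    monomial : ∀ y x e f {a a′ Y X} → a ≈ a′ → e + f ≡ r → y ^ e ≈ Y → x ^ f ≈ X →
               a * (y ^ e * x ^ (r ∸ e)) ≈ a′ * (Y * X)
    monomial y x e f a≈a′ e+f≡r y^e≈Y x^f≈X = *-cong a≈a′ (*-cong y^e≈Y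
      (trans (reflexive (≡.cong (x ^_) (≡.trans (≡.cong (_∸ e) (≡.sym e+f≡r)) (ℕ.m+n∸m≡n e f)))) x^f≈X))

  module _ (Q-additive : ∀ x y → (x ⊕ y) ^ Q ≈ x ^ Q ⊕ y ^ Q)
           (R-additive : ∀ x y → (x ⊕ y) ^ R ≈ x ^ R ⊕ y ^ R)
           (S-additive : ∀ x y → (x ⊕ y) ^ S ≈ x ^ S ⊕ y ^ S) where

    private
      linear-power : ∀ n → (∀ x y → (x ⊕ y) ^ n ≈ x ^ n ⊕ y ^ n) →
                     ∀ x y → (x ⊕ ω * y) ^ n ≈ x ^ n ⊕ ω ^ n * y ^ n
      linear-power n additive x y = trans (additive x (ω * y)) (+-congˡ (^-distrib-* ω y n))

    C₁⁽¹⁾-factorisation : ∀ y x → homogeneous r C₁⁽¹⁾ y x ≈ (x ⊕ ω * y) ^ r ⊕ κ * (y ⊕ ω * x) ^ r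
    C₁⁽¹⁾-factorisation y x = begin
      homogeneous r C₁⁽¹⁾ y x
        ≈⟨ +-cong (monomial y x r 0 (leading (^-homo₃ ω)) (ℕ.+-identityʳ r) (^-homo₃ y) refl)
          (+-cong (monomial y x (Q + R) S (coefficient S (^-homo-* ω Q R) refl) ≡.refl (^-homo-* y Q R) refl)
          (+-cong (monomial y x (Q + S) R (coefficient R (^-homo-* ω Q S) refl) ([Q+S]+R≡r Q R S) (^-homo-* y Q S) refl)
          (+-cong (monomial y x (R + S) Q (coefficient Q (^-homo-* ω R S) refl) ([R+S]+Q≡r Q R S) (^-homo-* y R S) refl)
          (+-cong (monomial y x Q (R + S) (coefficient (R + S) refl (^-homo-* ω R S)) (Q+[R+S]≡r Q R S) refl (^-homo-* x R S))
          (+-cong (monomial y x R (Q + S) (coefficient (Q + S) refl (^-homo-* ω Q S)) (R+[Q+S]≡r Q R S) refl (^-homo-* x Q S))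
          (+-cong (monomial y x S (Q + R) (coefficient (Q + R) refl (^-homo-* ω Q R)) (S+[Q+R]≡r Q R S) refl (^-homo-* x Q R))
          (+-cong (monomial y x 0 r (coefficient r refl (^-homo₃ ω)) ≡.refl refl (^-homo₃ x))
          refl))))))) ⟩
      _ ≈⟨ expansion₁ commutativeSemiring κ (ω ^ Q) (ω ^ R) (ω ^ S) (y ^ Q) (y ^ R) (y ^ S) (x ^ Q) (x ^ R) (x ^ S) ⟩
      _ ≈⟨ +-cong (powers x y) (*-congˡ (powers y x)) ⟨
      (x ⊕ ω * y) ^ r ⊕ κ * (y ⊕ ω * x) ^ r ∎
      where
      powers : ∀ x y → (x ⊕ ω * y) ^ r ≈
        (x ^ Q ⊕ ω ^ Q * y ^ Q) * (x ^ R ⊕ ω ^ R * y ^ R) * (x ^ S ⊕ ω ^ S * y ^ S)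
      powers x y = trans (^-homo₃ (x ⊕ ω * y))
        (*-cong (*-cong (linear-power Q Q-additive x y) (linear-power R R-additive x y)) (linear-power S S-additive x y))

    C₁⁽²⁾-factorisation : ∀ y x → let A = x ⊕ ω * y ; B = y ⊕ ω * x in
      homogeneous r C₁⁽²⁾ y x ≈ A ^ (Q + S) * B ^ R ⊕ κ * (B ^ (Q + S) * A ^ R)
    C₁⁽²⁾-factorisation y x = begin
      homogeneous r C₁⁽²⁾ y x
        ≈⟨ +-cong (monomial y x r 0 (coefficient R (^-homo-* ω Q S) refl) (ℕ.+-identityʳ r) (^-homo₃ y) refl)
          (+-cong (monomial y x (Q + R) S (coefficient (R + S) refl (^-homo-* ω R S)) ≡.refl (^-homo-* y Q R) refl)
          (+-cong (monomial y x (Q + S) R (leading (^-homo₃ ω)) ([Q+S]+R≡r Q R S) (^-homo-* y Q S) refl)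
          (+-cong (monomial y x (R + S) Q (coefficient (Q + R) refl (^-homo-* ω Q R)) ([R+S]+Q≡r Q R S) (^-homo-* y R S) refl)
          (+-cong (monomial y x Q (R + S) (coefficient S (^-homo-* ω Q R) refl) (Q+[R+S]≡r Q R S) refl (^-homo-* x R S))
          (+-cong (monomial y x R (Q + S) (coefficient r refl (^-homo₃ ω)) (R+[Q+S]≡r Q R S) refl (^-homo-* x Q S))
          (+-cong (monomial y x S (Q + R) (coefficient Q (^-homo-* ω R S) refl) (S+[Q+R]≡r Q R S) refl (^-homo-* x Q R))
          (+-cong (monomial y x 0 r (coefficient (Q + S) refl (^-homo-* ω Q S)) ≡.refl refl (^-homo₃ x))
          refl))))))) ⟩
      _ ≈⟨ expansion₂ commutativeSemiring κ (ω ^ Q) (ω ^ R) (ω ^ S) (y ^ Q) (y ^ R) (y ^ S) (x ^ Q) (x ^ R) (x ^ S) ⟩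
      _ ≈⟨ +-cong (powers x y) (*-congˡ (powers y x)) ⟨
      (x ⊕ ω * y) ^ (Q + S) * (y ⊕ ω * x) ^ R ⊕ κ * ((y ⊕ ω * x) ^ (Q + S) * (x ⊕ ω * y) ^ R) ∎
      where
      powers : ∀ x y → (x ⊕ ω * y) ^ (Q + S) * (y ⊕ ω * x) ^ R ≈
        (x ^ Q ⊕ ω ^ Q * y ^ Q) * (x ^ S ⊕ ω ^ S * y ^ S) * (y ^ R ⊕ ω ^ R * x ^ R)
      powers x y = *-cong
        (trans (^-homo-* (x ⊕ ω * y) Q S) (*-cong (linear-power Q Q-additive x y) (linear-power S S-additive x y)))
        (linear-power R R-additive y x)

-- Powers of roots of unity, and the nonvanishing of `β₁` and `β₂`

3∤primePower : ∀ {p} → Prime p → p ≢ 3 → ∀ {n} → PowerOf p n → ¬ 3 ∣ n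
3∤primePower p-prime p≢3 (i , ≡.refl) 3∣p^i
  with prime⇒irreducible p-prime (prime∣^ (from-yes (prime? 3)) _ i 3∣p^i)
... | inj₁ ()
... | inj₂ 3≡p = p≢3 (≡.sym 3≡p)

module RootOfUnity (K : Field c ℓ) (ω : Field.Carrier K) (ω≉0 : Field._≉_ K ω (Field.0# K))
                   {n : ℕ} .{{_ : Nat.NonZero n}} (ω-order : Field.HasOrder K ω n) where
  open Field K hiding (zero)
  open FieldProperties K
  open SemiringExp semiring using (^-congˡ; ^-homo-*; ^-assocʳ)
  open SetoidReasoning setoid

  1^m≈1 : ∀ m → 1# ^ m ≈ 1#
  1^m≈1 zero    = refl
  1^m≈1 (suc m) = trans (*-identityˡ _) (1^m≈1 m)

  ω^m≈ω^[m%n] : ∀ m → ω ^ m ≈ ω ^ (m % n)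
  ω^m≈ω^[m%n] m = begin
    ω ^ m                                    ≡⟨ ≡.cong (ω ^_) (m≡m%n+[m/n]*n m n) ⟩
    ω ^ (m % n Nat.+ (m / n) Nat.* n)        ≡⟨ ≡.cong (λ k → ω ^ (m % n Nat.+ k)) (ℕ.*-comm (m / n) n) ⟩
    ω ^ (m % n Nat.+ n Nat.* (m / n))        ≈⟨ ^-homo-* ω (m % n) (n Nat.* (m / n)) ⟩
    ω ^ (m % n) * ω ^ (n Nat.* (m / n))      ≈⟨ *-congˡ (^-assocʳ ω n (m / n)) ⟨
    ω ^ (m % n) * (ω ^ n) ^ (m / n)          ≈⟨ *-congˡ (^-congˡ (m / n) (proj₁ (proj₂ ω-order))) ⟩
    ω ^ (m % n) * 1# ^ (m / n)               ≈⟨ *-congˡ (1^m≈1 (m / n)) ⟩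
    ω ^ (m % n) * 1#                         ≈⟨ *-identityʳ _ ⟩
    ω ^ (m % n)                              ∎

  %≡⇒^≈ : ∀ i j → i % n ≡ j % n → ω ^ i ≈ ω ^ j
  %≡⇒^≈ i j eq = trans (ω^m≈ω^[m%n] i)
    (trans (reflexive (≡.cong (ω ^_) eq)) (sym (ω^m≈ω^[m%n] j)))

  private
    -- Cancelling ω^i would give ω^(j-i) = 1 with 0 < j - i < n, against the minimality of the
    -- order.
    no-collision : ∀ {i j} → i < j → j < n → ω ^ i ≉ ω ^ j
    no-collision {i} {j} i<j j<n eq = proj₂ (proj₂ ω-order) (j ∸ i) (ℕ.m<n⇒0<n∸m i<j)
      (ℕ.≤-<-trans (ℕ.m∸n≤m j i) j<n)
      (*-cancelˡ (ω ^ i) (x≉0⇒x^n≉0 ω≉0 i) (begin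
        ω ^ i * ω ^ (j ∸ i)       ≈⟨ ^-homo-* ω i (j ∸ i) ⟨
        ω ^ (i Nat.+ (j ∸ i))     ≡⟨ ≡.cong (ω ^_) (ℕ.m+[n∸m]≡n (ℕ.<⇒≤ i<j)) ⟩
        ω ^ j                     ≈⟨ eq ⟨
        ω ^ i                     ≈⟨ *-identityʳ _ ⟨
        ω ^ i * 1#                ∎))

  ^≈⇒%≡ : ∀ i j → ω ^ i ≈ ω ^ j → i % n ≡ j % n
  ^≈⇒%≡ i j eq with ℕ.<-cmp (i % n) (j % n) | trans (sym (ω^m≈ω^[m%n] i)) (trans eq (ω^m≈ω^[m%n] j))
  ... | tri< i<j _ _ | eq′ = contradiction eq′ (no-collision i<j (m%n<n j n))
  ... | tri≈ _ i≡j _ | _   = i≡j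
  ... | tri> _ _ j<i | eq′ = contradiction (sym eq′) (no-collision j<i (m%n<n i n))

module CubeRootOfUnity (K : Field c ℓ) (ω : Field.Carrier K) (ω≉0 : Field._≉_ K ω (Field.0# K))
                       (ω-order : Field.HasOrder K ω 3) where
  open Field K hiding (zero; _+_)
  open FieldProperties K
  open RootOfUnity K ω ω≉0 ω-order
  open GroupProperties +-group using (x∙y⁻¹≈ε⇒x≈y)
  open SemiringExp semiring using (^-homo-*)
  open SetoidReasoning setoid

  ω≉1 : ω ≉ 1#
  ω≉1 ω≈1 = proj₂ (proj₂ ω-order) 1 (s≤s z≤n) (s≤s (s≤s z≤n)) (trans (*-identityʳ ω) ω≈1)

  ω*ω≉1 : ω * ω ≉ 1#
  ω*ω≉1 ω²≈1 = proj₂ (proj₂ ω-order) 2 (s≤s z≤n) (s≤s (s≤s (s≤s z≤n)))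
    (trans (*-congˡ (*-identityʳ ω)) ω²≈1)

  ω*[ω*ω]≈1 : ω * (ω * ω) ≈ 1#
  ω*[ω*ω]≈1 = trans (*-congˡ (*-congˡ (sym (*-identityʳ ω)))) (proj₁ (proj₂ ω-order))

  module _ (Q R S : ℕ) (3∤S : ¬ 3 ∣ S) where
    open Nat using (_+_)
    open Families K ω Q R S using (β₁; β₂)

    private
      -- Cancelling e would give ω^(2S) = 1, so 3 would divide 2S and hence S.
      no-return : ∀ {e} → e ≉ 0# → e * ω ^ S * ω ^ S ≉ e
      no-return {e} e≉0 eq = 3∤S (3∣2S⇒3∣S (m%n≡0⇒n∣m (S + S) 3 (^≈⇒%≡ (S + S) 0
        (*-cancelˡ e e≉0 (begin
          e * ω ^ (S + S)      ≈⟨ *-congˡ (^-homo-* ω S S) ⟩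
          e * (ω ^ S * ω ^ S)  ≈⟨ *-assoc _ _ _ ⟨
          e * ω ^ S * ω ^ S    ≈⟨ eq ⟩
          e                    ≈⟨ *-identityʳ e ⟨
          e * 1#               ∎)))))
        where
        3∣2S⇒3∣S : 3 ∣ S + S → 3 ∣ S
        3∣2S⇒3∣S 3∣2S with euclidsLemma 2 S (from-yes (prime? 3))
          (≡.subst (λ n → 3 ∣ S + n) (≡.sym (ℕ.+-identityʳ S)) 3∣2S)
        ... | inj₁ 3∣2 = contradiction 3∣2 (from-no (3 ∣? 2))
        ... | inj₂ 3∣S = 3∣S

    -- The test r ≡ 1 (mod 3) holds exactly when ω^r = ω, that is, when the other candidate for `β₁`
    -- vanishes. If ω^(Q+R) = ω^(S+1) held as well, multiplying by ω^S would give ω = ω · ω^(2S),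
    -- which `no-return` excludes.
    β₁≉0 : β₁ ≉ 0#
    β₁≉0 = if-elim (_≉ 0#) ((Q + R + S) % 3 Nat.≟ 1)
      (λ r≡1 β≈0 → no-return ω≉0 (begin
        ω * ω ^ S * ω ^ S   ≈⟨ *-congʳ (*-comm ω (ω ^ S)) ⟩
        ω ^ S * ω * ω ^ S   ≈⟨ *-congʳ (*-congˡ (*-identityʳ ω)) ⟨
        ω ^ S * ω ^ 1 * ω ^ S ≈⟨ *-congʳ (^-homo-* ω S 1) ⟨
        ω ^ (S + 1) * ω ^ S ≈⟨ *-congʳ (x∙y⁻¹≈ε⇒x≈y _ _ β≈0) ⟨
        ω ^ (Q + R) * ω ^ S ≈⟨ ^-homo-* ω (Q + R) S ⟨
        ω ^ (Q + R + S)     ≈⟨ %≡⇒^≈ (Q + R + S) 1 r≡1 ⟩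
        ω ^ 1               ≈⟨ *-identityʳ ω ⟩
        ω                   ∎))
      (λ r≢1 β≈0 → r≢1 (^≈⇒%≡ (Q + R + S) 1
        (trans (x∙y⁻¹≈ε⇒x≈y _ _ β≈0) (sym (*-identityʳ ω)))))

    -- The same argument with ω^(R+1) in place of ω: if both candidates vanished, then ω^(R+1) =
    -- ω^(Q+S) = ω^(R+S+1) ω^S.
    β₂≉0 : β₂ ≉ 0#
    β₂≉0 = if-elim (_≉ 0#) ((Q + S) % 3 Nat.≟ (R + 1) % 3)
      (λ eq β≈0 → no-return (x≉0⇒x^n≉0 ω≉0 (R + 1)) (begin
        ω ^ (R + 1) * ω ^ S * ω ^ S   ≈⟨ *-congʳ (^-homo-* ω (R + 1) S) ⟨
        ω ^ (R + 1 + S) * ω ^ S       ≡⟨ ≡.cong (λ k → ω ^ k * ω ^ S)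
                                           (≡.trans (ℕ.+-assoc R 1 S) (≡.trans (≡.cong (R +_) (ℕ.+-comm 1 S)) (≡.sym (ℕ.+-assoc R S 1)))) ⟩
        ω ^ (R + S + 1) * ω ^ S       ≈⟨ *-congʳ (x∙y⁻¹≈ε⇒x≈y _ _ β≈0) ⟨
        ω ^ Q * ω ^ S                 ≈⟨ ^-homo-* ω Q S ⟨
        ω ^ (Q + S)                   ≈⟨ %≡⇒^≈ (Q + S) (R + 1) eq ⟩
        ω ^ (R + 1)                   ∎))
      (λ neq β≈0 → neq (^≈⇒%≡ (Q + S) (R + 1) (x∙y⁻¹≈ε⇒x≈y _ _ β≈0)))

-- The extension F_{q²} / F_q

module QuadraticExtension
  {p k q : ℕ} (p-prime : Prime p) (q≡p^k : q ≡ p Nat.^ k)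
  (F : Field c ℓ) (K : Field c′ ℓ′)
  (cardF : HasCardinality (Field.setoid F) q)
  (cardK : HasCardinality (Field.setoid K) (q Nat.^ 2))
  {ι : Field.Carrier F → Field.Carrier K}
  (ι-hom : IsRingHomomorphism (Field.rawRing F) (Field.rawRing K) ι) where

  private
    module F = Field F
    module ι = IsRingHomomorphism ι-hom
  open Field K hiding (zero)
  open FieldProperties K
  open FiniteField K cardK using (_≟_; p·1≈0)
  open GroupProperties +-group using (inverseˡ-unique) renaming (∙-cancelʳ to +-cancelʳ)
  open RingProperties ring using (x+x≈x⇒x≈0)
  open SemiringExp semiring using (^-congˡ; ^-assocʳ)
  open CommutativeExp commutativeSemiring using (^-distrib-*)
  open SemiringSolver commutativeSemiring using (solve; _:=_; _:+_; _:*_)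
  open SetoidReasoning setoid

  K/F : Module F.commutativeRing c′ ℓ′
  K/F = extensionModule F K ι-hom
  F×F : Module F.commutativeRing c ℓ
  F×F = squareModule F

  q²≡p^2k : q Nat.^ 2 ≡ p Nat.^ (k Nat.* 2)
  q²≡p^2k = ≡.trans (≡.cong (Nat._^ 2) q≡p^k) (ℕ.^-*-assoc p k 2)

  powerOf-additive : ∀ {n} → PowerOf p n → ∀ x y → (x + y) ^ n ≈ x ^ n + y ^ n
  powerOf-additive (i , ≡.refl) =
    ^-homo-+-primePower commutativeSemiring p-prime (p·1≈0 p (k Nat.* 2) q²≡p^2k) i

  bar : Carrier → Carrier
  bar x = x ^ q

  bar-cong : ∀ {x y} → x ≈ y → bar x ≈ bar y
  bar-cong = ^-congˡ q

  bar-+ : ∀ x y → bar (x + y) ≈ bar x + bar y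
  bar-+ = powerOf-additive (k , q≡p^k)

  bar-* : ∀ x y → bar (x * y) ≈ bar x * bar y
  bar-* x y = ^-distrib-* x y q

  bar-^ : ∀ x n → bar (x ^ n) ≈ bar x ^ n
  bar-^ x n = trans (^-assocʳ x n q)
    (trans (reflexive (≡.cong (x ^_) (ℕ.*-comm n q))) (sym (^-assocʳ x q n)))

  bar-0 : bar 0# ≈ 0#
  bar-0 = x+x≈x⇒x≈0 (bar 0#) (trans (sym (bar-+ 0# 0#)) (bar-cong (+-identityˡ 0#)))

  bar-neg : ∀ x → bar (- x) ≈ - bar x
  bar-neg x = inverseˡ-unique (bar (- x)) (bar x)
    (trans (sym (bar-+ (- x) x)) (trans (bar-cong (-‿inverseˡ x)) bar-0))

  bar-involutive : ∀ x → bar (bar x) ≈ x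
  bar-involutive x = begin
    (x ^ q) ^ q       ≈⟨ ^-assocʳ x q q ⟩
    x ^ (q Nat.* q)   ≡⟨ ≡.cong (λ n → x ^ (q Nat.* n)) (ℕ.*-identityʳ q) ⟨
    x ^ (q Nat.^ 2)   ≈⟨ x^cardinality≈x K cardK x ⟩
    x                 ∎

  ι-^ : ∀ s n → ι (s F.^ n) ≈ ι s ^ n
  ι-^ s zero    = ι.1#-homo
  ι-^ s (suc n) = trans (ι.*-homo s (s F.^ n)) (*-congˡ (ι-^ s n))

  bar-ι : ∀ s → bar (ι s) ≈ ι s
  bar-ι s = trans (sym (ι-^ s q)) (ι.⟦⟧-cong (x^cardinality≈x F cardF s))

  ι-kernel : ∀ {s} → ι s ≈ 0# → s F.≈ F.0#
  ι-kernel {s} ιs≈0 with FiniteField._≟_ F cardF s F.0#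
  ... | yes s≈0 = s≈0
  ... | no  s≉0 = contradiction (begin
    0#                ≈⟨ zeroˡ _ ⟨
    0# * ι (s F.⁻¹)   ≈⟨ *-congʳ ιs≈0 ⟨
    ι s * ι (s F.⁻¹)  ≈⟨ ι.*-homo s (s F.⁻¹) ⟨
    ι (s F.* s F.⁻¹)  ≈⟨ ι.⟦⟧-cong (F.*-inverse s s≉0) ⟩
    ι F.1#            ≈⟨ ι.1#-homo ⟩
    1#                ∎) 0≉1

  -- Both kernel computations end here: with c = u² for `twist`, and with c = ω for the independence
  -- of 1 and ω over F_q.
  y≈cy⇒y≈0 : ∀ {c y} → c ≉ 1# → y ≈ c * y → y ≈ 0#
  y≈cy⇒y≈0 {c} {y} c≉1 y≈cy with y ≟ 0#
  ... | yes y≈0 = y≈0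
  ... | no  y≉0 = contradiction
    (*-cancelˡ y y≉0 (trans (*-comm y c) (trans (sym y≈cy) (sym (*-identityʳ y))))) c≉1

  bar-isLinear : ∀ s x → bar (ι s * x) ≈ ι s * bar x
  bar-isLinear s x = trans (bar-* (ι s) x) (*-congʳ (bar-ι s))

  bar-iso : IsModuleIsomorphism (Module.rawModule K/F) (Module.rawModule K/F) bar
  bar-iso = finite-linear⇒iso K/F K/F cardK cardK bar bar-cong bar-+ bar-isLinear
    (λ x x̄≈0 → trans (sym (bar-involutive x)) (trans (bar-cong x̄≈0) bar-0))

  -- One shape serves both sides of the equivalence when q ≡ 1: b = 1 and u = ω give x ↦ A, while u
  -- = -ω with b the inverse of `β₁` or `β₂` gives the outer map.
  twist : Carrier → Carrier → Carrier → Carrier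
  twist b u y = b * (y + u * bar y)

  -- On the kernel y + u ȳ vanishes, and so does u times its conjugate, which is u ȳ + u² y.
  -- Comparing the two leaves y = u² y.
  twist-iso : ∀ {b u} → b ≉ 0# → bar u ≈ u → u * u ≉ 1# →
              IsModuleIsomorphism (Module.rawModule K/F) (Module.rawModule K/F) (twist b u)
  twist-iso {b} {u} b≉0 ū≈u u²≉1 = finite-linear⇒iso K/F K/F cardK cardK (twist b u)
    (λ x≈y → *-congˡ (+-cong x≈y (*-congˡ (bar-cong x≈y))))
    (λ x y → trans (*-congˡ (+-congˡ (*-congˡ (bar-+ x y))))
      (solve 6 (λ b u x y x̄ ȳ → b :* (x :+ y :+ u :* (x̄ :+ ȳ)) :=
                                b :* (x :+ u :* x̄) :+ b :* (y :+ u :* ȳ)) refl b u x y (bar x) (bar y)))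
    (λ s x → trans (*-congˡ (+-congˡ (*-congˡ (bar-isLinear s x))))
      (solve 5 (λ b u s x x̄ → b :* (s :* x :+ u :* (s :* x̄)) := s :* (b :* (x :+ u :* x̄)))
        refl b u (ι s) x (bar x)))
    kernel
    where
    kernel : ∀ y → twist b u y ≈ 0# → y ≈ 0#
    kernel y eq = y≈cy⇒y≈0 u²≉1 (+-cancelʳ (u * bar y) y (u * u * y) (begin
      y + u * bar y                        ≈⟨ y+uȳ≈0 ⟩
      0#                                   ≈⟨ zeroʳ u ⟨
      u * 0#                               ≈⟨ *-congˡ bar-0 ⟨
      u * bar 0#                           ≈⟨ *-congˡ (bar-cong y+uȳ≈0) ⟨
      u * bar (y + u * bar y)              ≈⟨ *-congˡ (bar-+ y (u * bar y)) ⟩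
      u * (bar y + bar (u * bar y))        ≈⟨ *-congˡ (+-congˡ (trans (bar-* u (bar y)) (*-cong ū≈u (bar-involutive y)))) ⟩
      u * (bar y + u * y)                  ≈⟨ solve 3 (λ u y ȳ → u :* (ȳ :+ u :* y) := u :* u :* y :+ u :* ȳ) refl u y (bar y) ⟩
      u * u * y + u * bar y                ∎))
      where
      y+uȳ≈0 : y + u * bar y ≈ 0#
      y+uȳ≈0 = xy≈0⇒y≈0 b≉0 eq

  -- The counterpart of `twist` for q ≡ 2: the inner map is the inverse of such a combination, the
  -- outer map is another one with the same u and a different b.
  combination : Carrier → Carrier → F.Carrier × F.Carrier → Carrier
  combination b u (s , t) = b * (ι s + u * ι t)

  combination-iso : ∀ {b u} → b ≉ 0# → (∀ {s t} → ι s + u * ι t ≈ 0# → ι t ≈ 0#) →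
                    IsModuleIsomorphism (Module.rawModule F×F) (Module.rawModule K/F) (combination b u)
  combination-iso {b} {u} b≉0 independent = finite-linear⇒iso F×F K/F
    -- The power `q ^ 2` unfolds to `q * (q * 1)`, whereas the product has `q * q` elements.
    (≡.subst (HasCardinality (Module.≈ᴹ-setoid F×F)) (≡.cong (q Nat.*_) (≡.sym (ℕ.*-identityʳ q)))
      (×-cardinality cardF cardF))
    cardK (combination b u)
    (λ (s≈ , t≈) → *-congˡ (+-cong (ι.⟦⟧-cong s≈) (*-congˡ (ι.⟦⟧-cong t≈))))
    (λ (s , t) (s′ , t′) → trans
      (*-congˡ (+-cong (ι.+-homo s s′) (*-congˡ (ι.+-homo t t′))))
      (solve 6 (λ b u s t s′ t′ → b :* (s :+ s′ :+ u :* (t :+ t′)) :=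
                                  b :* (s :+ u :* t) :+ b :* (s′ :+ u :* t′))
        refl b u (ι s) (ι t) (ι s′) (ι t′)))
    (λ e (s , t) → trans
      (*-congˡ (+-cong (ι.*-homo e s) (*-congˡ (ι.*-homo e t))))
      (solve 5 (λ b u e s t → b :* (e :* s :+ u :* (e :* t)) := e :* (b :* (s :+ u :* t)))
        refl b u (ι e) (ι s) (ι t)))
    (λ (s , t) eq →
      let s+ut≈0 = xy≈0⇒y≈0 b≉0 eq
          t≈0    = independent s+ut≈0
      in ι-kernel (trans (sym (+-identityʳ (ι s)))
           (trans (+-congˡ (sym (trans (*-congˡ t≈0) (zeroʳ u)))) s+ut≈0))
       , ι-kernel t≈0)

-- The four equivalences for z = 1, and the passage to z = 2

module Equivalences
  {p k q Q R S : ℕ} (p-prime : Prime p) (p≢3 : p ≢ 3) (q≡p^k : q ≡ p Nat.^ k)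
  (Q-power : PowerOf p Q) (R-power : PowerOf p R) (S-power : PowerOf p S)
  (F : Field c ℓ) (K : Field c′ ℓ′)
  (cardF : HasCardinality (Field.setoid F) q)
  (cardK : HasCardinality (Field.setoid K) (q Nat.^ 2))
  {ι : Field.Carrier F → Field.Carrier K}
  (ι-hom : IsRingHomomorphism (Field.rawRing F) (Field.rawRing K) ι)
  (ω : Field.Carrier K) (ω≉0 : Field._≉_ K ω (Field.0# K)) (ω-order : Field.HasOrder K ω 3) where

  private
    module F = Field F
    module ι = IsRingHomomorphism ι-hom
  open Field K hiding (zero)
  open FieldProperties K
  open QuadraticExtension {k = k} p-prime q≡p^k F K cardF cardK ι-hom
  open Families K ω Q R S
  open Polynomial K using (eval; scale; reciprocal)
  open Homogenization K
  open Factorisation K ω Q R S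
  open RootOfUnity K ω ω≉0 ω-order using (%≡⇒^≈)
  open CubeRootOfUnity K ω ω≉0 ω-order
  open GroupProperties +-group using (x∙y⁻¹≈ε⇒x≈y)
  open RingProperties ring using (-‿distribˡ-*; -‿distribʳ-*; -‿involutive)
  open SemiringExp semiring using (^-congˡ; ^-homo-*; ^-assocʳ)
  open CommutativeExp commutativeSemiring using (^-distrib-*)
  open SemiringSolver commutativeSemiring using (solve; _:=_; _:+_; _:*_; con)
  open SetoidReasoning setoid

  private
    κ = - ω

    A B : Carrier → Carrier
    A x = x + ω * bar x
    B x = bar x + ω * x

    q≥1 : 1 ≤ q
    q≥1 = ≡.subst (1 ≤_) (≡.sym q≡p^k) (ℕ.m^n>0 p {{prime⇒nonZero p-prime}} k)

    3∤S : ¬ 3 ∣ S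
    3∤S = 3∤primePower p-prime p≢3 S-power

    β₁⁻¹≉0 : β₁ ⁻¹ ≉ 0#
    β₁⁻¹≉0 = x≉0⇒x⁻¹≉0 (β₁≉0 Q R S 3∤S)

    β₂⁻¹≉0 : β₂ ⁻¹ ≉ 0#
    β₂⁻¹≉0 = x≉0⇒x⁻¹≉0 (β₂≉0 Q R S 3∤S)

    κ*κ≈ω*ω : κ * κ ≈ ω * ω
    κ*κ≈ω*ω = begin
      - ω * - ω      ≈⟨ -‿distribˡ-* ω (- ω) ⟨
      - (ω * - ω)    ≈⟨ -‿cong (-‿distribʳ-* ω ω) ⟨
      - - (ω * ω)    ≈⟨ -‿involutive (ω * ω) ⟩
      ω * ω          ∎

  f₁-formula : ∀ x → f₁ q zero x ≈ β₁ ⁻¹ * (A x ^ r + κ * B x ^ r)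
  f₁-formula x = trans (eval-homogeneous q≥1 C₁⁽¹⁾-degree (β₁ ⁻¹) x)
    (*-congˡ (C₁⁽¹⁾-factorisation (powerOf-additive Q-power) (powerOf-additive R-power)
                                  (powerOf-additive S-power) (bar x) x))

  f₂-formula : ∀ x → f₂ q zero x ≈
    β₂ ⁻¹ * (A x ^ (Q Nat.+ S) * B x ^ R + κ * (B x ^ (Q Nat.+ S) * A x ^ R))
  f₂-formula x = trans (eval-homogeneous q≥1 C₁⁽²⁾-degree (β₂ ⁻¹) x)
    (*-congˡ (C₁⁽²⁾-factorisation (powerOf-additive Q-power) (powerOf-additive R-power)
                                  (powerOf-additive S-power) (bar x) x))

  eval-reciprocal : ∀ {P} → HasDegree≤ r P → ∀ b x →
    x ^ r * eval (scale b (reciprocal r P)) (x ^ (q ∸ 1)) ≈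
    bar x ^ r * eval (scale b P) (bar x ^ (q ∸ 1))
  eval-reciprocal {P} P≤r b x = begin
    x ^ r * eval (scale b (reciprocal r P)) (x ^ (q ∸ 1))
      ≈⟨ eval-homogeneous q≥1 (reciprocal-degree r P) b x ⟩
    b * homogeneous r (reciprocal r P) (bar x) x
      ≈⟨ *-congˡ (homogeneous-reciprocal r P≤r (bar x) x) ⟩
    b * homogeneous r P x (bar x)
      ≈⟨ *-congˡ (homogeneous-cong r P (bar-involutive x) refl) ⟨
    b * homogeneous r P (bar (bar x)) (bar x)
      ≈⟨ eval-homogeneous q≥1 P≤r b (bar x) ⟨
    bar x ^ r * eval (scale b P) (bar x ^ (q ∸ 1)) ∎

  private
    bar-A : ∀ x {ω̄} → bar ω ≈ ω̄ → bar (A x) ≈ bar x + ω̄ * x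
    bar-A x ω̄≈ = trans (bar-+ x (ω * bar x))
      (+-congˡ (trans (bar-* ω (bar x)) (*-cong ω̄≈ (bar-involutive x))))

  module _ (q≡1 : q % 3 ≡ 1) where
    private
      ω̄≈ω : bar ω ≈ ω
      ω̄≈ω = trans (%≡⇒^≈ q 1 q≡1) (*-identityʳ ω)

      κ̄≈κ : bar κ ≈ κ
      κ̄≈κ = trans (bar-neg ω) (-‿cong ω̄≈ω)

      κ*κ≉1 : κ * κ ≉ 1#
      κ*κ≉1 κ²≈1 = ω*ω≉1 (trans (sym κ*κ≈ω*ω) κ²≈1)

      η : Carrier → Carrier
      η = twist 1# ω

      η≈A : ∀ x → η x ≈ A x
      η≈A x = *-identityˡ (A x)

      η̄≈B : ∀ x → bar (η x) ≈ B x
      η̄≈B x = trans (bar-cong (η≈A x)) (bar-A x ω̄≈ω)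

      bar-B : ∀ x → bar (B x) ≈ A x
      bar-B x = trans (bar-cong (sym (bar-A x ω̄≈ω))) (bar-involutive (A x))

      -- In both families the second term is κ times the conjugate of the first, so the outer
      -- isomorphism is `twist b κ`; it is bijective because κ̄ = κ and κ² = ω² ≠ 1.
      twisted-equivalence : ∀ b f g → b ≉ 0# →
        (∀ x → f x ≈ b * (g (η x) + κ * bar (g (η x)))) → LinearlyEquivalent K/F K/F f g
      twisted-equivalence b f g b≉0 f≈ = twist b κ , η , twist-iso b≉0 κ̄≈κ κ*κ≉1 ,
        twist-iso (λ 1≈0 → 0≉1 (sym 1≈0)) ω̄≈ω ω*ω≉1 , f≈

    f₁-equivalent-q≡1 : LinearlyEquivalent K/F K/F (f₁ q zero) (_^ (Q Nat.+ R Nat.+ S))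
    f₁-equivalent-q≡1 = twisted-equivalence (β₁ ⁻¹) (f₁ q zero) (_^ r) β₁⁻¹≉0 λ x →
      trans (f₁-formula x) (*-congˡ (sym (+-cong (^-congˡ r (η≈A x))
        (*-congˡ (trans (bar-^ (η x) r) (^-congˡ r (η̄≈B x)))))))

    f₂-equivalent-q≡1 : LinearlyEquivalent K/F K/F (f₂ q zero) (_^ (Q Nat.+ q Nat.* R Nat.+ S))
    f₂-equivalent-q≡1 = twisted-equivalence (β₂ ⁻¹) (f₂ q zero) (_^ (Q Nat.+ q Nat.* R Nat.+ S)) β₂⁻¹≉0 λ x →
      trans (f₂-formula x) (*-congˡ (sym (+-cong (power x) (*-congˡ (bar-power x)))))
      where
      exponent : ∀ a b d → a Nat.+ b Nat.+ d ≡ a Nat.+ d Nat.+ b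
      exponent a b d = ≡.trans (ℕ.+-assoc a b d)
        (≡.trans (≡.cong (a Nat.+_) (ℕ.+-comm b d)) (≡.sym (ℕ.+-assoc a d b)))

      -- The exponent qR of the target function arises here: B x is the conjugate of `η x`, so its
      -- R-th power is the qR-th power of `η x`.
      power : ∀ x → η x ^ (Q Nat.+ q Nat.* R Nat.+ S) ≈ A x ^ (Q Nat.+ S) * B x ^ R
      power x = begin
        η x ^ (Q Nat.+ q Nat.* R Nat.+ S)        ≡⟨ ≡.cong (η x ^_) (exponent Q (q Nat.* R) S) ⟩
        η x ^ (Q Nat.+ S Nat.+ q Nat.* R)        ≈⟨ ^-homo-* (η x) (Q Nat.+ S) (q Nat.* R) ⟩
        η x ^ (Q Nat.+ S) * η x ^ (q Nat.* R)    ≈⟨ *-congˡ (^-assocʳ (η x) q R) ⟨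
        η x ^ (Q Nat.+ S) * bar (η x) ^ R        ≈⟨ *-cong (^-congˡ (Q Nat.+ S) (η≈A x)) (^-congˡ R (η̄≈B x)) ⟩
        A x ^ (Q Nat.+ S) * B x ^ R              ∎

      bar-power : ∀ x → bar (η x ^ (Q Nat.+ q Nat.* R Nat.+ S)) ≈ B x ^ (Q Nat.+ S) * A x ^ R
      bar-power x = begin
        bar (η x ^ (Q Nat.+ q Nat.* R Nat.+ S))      ≈⟨ bar-cong (power x) ⟩
        bar (A x ^ (Q Nat.+ S) * B x ^ R)            ≈⟨ bar-* _ _ ⟩
        bar (A x ^ (Q Nat.+ S)) * bar (B x ^ R)      ≈⟨ *-cong (bar-^ (A x) (Q Nat.+ S)) (bar-^ (B x) R) ⟩
        bar (A x) ^ (Q Nat.+ S) * bar (B x) ^ R      ≈⟨ *-cong (^-congˡ (Q Nat.+ S) (bar-A x ω̄≈ω)) (^-congˡ R (bar-B x)) ⟩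
        B x ^ (Q Nat.+ S) * A x ^ R                  ∎

  module _ (q≡2 : q % 3 ≡ 2) where
    private
      ω̄≈ω*ω : bar ω ≈ ω * ω
      ω̄≈ω*ω = trans (%≡⇒^≈ q 2 q≡2) (*-congˡ (*-identityʳ ω))

      -- From s = ωt, conjugation, which fixes s and t and squares ω, gives s = ω²t; hence t = ωt.
      independent : ∀ {s t} → ι s + κ * ι t ≈ 0# → ι t ≈ 0#
      independent {s} {t} eq = y≈cy⇒y≈0 ω≉1 (*-cancelˡ ω ω≉0 (begin
        ω * ι t            ≈⟨ s≈ωt ⟨
        ι s                ≈⟨ bar-ι s ⟨
        bar (ι s)          ≈⟨ bar-cong s≈ωt ⟩
        bar (ω * ι t)      ≈⟨ bar-* ω (ι t) ⟩
        bar ω * bar (ι t)  ≈⟨ *-cong ω̄≈ω*ω (bar-ι t) ⟩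
        ω * ω * ι t        ≈⟨ *-assoc ω ω (ι t) ⟩
        ω * (ω * ι t)      ∎))
        where
        s≈ωt : ι s ≈ ω * ι t
        s≈ωt = x∙y⁻¹≈ε⇒x≈y _ _ (trans (+-congˡ (-‿distribˡ-* ω (ι t))) eq)

      -- τ = 1 − ω²; since bar τ = − ω τ, the point x = τ (a − ω b) has A x = τ² a and B x = τ² b.
      τ : Carrier
      τ = 1# + κ * ω

      τ≉0 : τ ≉ 0#
      τ≉0 τ≈0 = ω*ω≉1 (sym (x∙y⁻¹≈ε⇒x≈y _ _ (trans (+-congˡ (-‿distribˡ-* ω ω)) τ≈0)))

      κ̄≈κ*ω : bar κ ≈ κ * ω
      κ̄≈κ*ω = trans (bar-neg ω) (trans (-‿cong ω̄≈ω*ω) (-‿distribˡ-* ω ω))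

      κ*κ*ω≈1 : κ * κ * ω ≈ 1#
      κ*κ*ω≈1 = trans (*-congʳ κ*κ≈ω*ω) (trans (*-assoc ω ω ω) ω*[ω*ω]≈1)

      τ̄≈κ*τ : bar τ ≈ κ * τ
      τ̄≈κ*τ = begin
        bar (1# + κ * ω)            ≈⟨ bar-+ 1# (κ * ω) ⟩
        bar 1# + bar (κ * ω)        ≈⟨ +-cong bar-1 (trans (bar-* κ ω) (*-cong κ̄≈κ*ω ω̄≈ω*ω)) ⟩
        1# + κ * ω * (ω * ω)        ≈⟨ +-congˡ (*-assoc κ ω (ω * ω)) ⟩
        1# + κ * (ω * (ω * ω))      ≈⟨ +-congˡ (*-congˡ ω*[ω*ω]≈1) ⟩
        1# + κ * 1#                 ≈⟨ +-congʳ κ*κ*ω≈1 ⟨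
        κ * κ * ω + κ * 1#          ≈⟨ solve 2 (λ κ ω → κ :* κ :* ω :+ κ :* con 1 := κ :* (con 1 :+ κ :* ω)) refl κ ω ⟩
        κ * (1# + κ * ω)            ∎
        where
        bar-1 : bar 1# ≈ 1#
        bar-1 = trans (bar-cong (sym ι.1#-homo)) (trans (bar-ι F.1#) ι.1#-homo)

      τ-iso : IsModuleIsomorphism (Module.rawModule F×F) (Module.rawModule K/F) (combination τ κ)
      τ-iso = combination-iso τ≉0 independent

      η : Carrier → F.Carrier × F.Carrier
      η = inverse F×F K/F τ-iso

      η₁ η₂ : Carrier → Carrier
      η₁ x = ι (proj₁ (η x))
      η₂ x = ι (proj₂ (η x))

      x≈ : ∀ x → x ≈ τ * (η₁ x + κ * η₂ x)
      x≈ x = sym (f-inverse F×F K/F τ-iso x)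

      -- Conjugation sends τ to κτ and κτ back to κ²ωτ = τ, so it exchanges the two coordinates.
      x̄≈ : ∀ x → bar x ≈ τ * (η₂ x + κ * η₁ x)
      x̄≈ x = begin
        bar x                                           ≈⟨ bar-cong (x≈ x) ⟩
        bar (τ * (η₁ x + κ * η₂ x))                     ≈⟨ bar-* _ _ ⟩
        bar τ * bar (η₁ x + κ * η₂ x)                   ≈⟨ *-cong τ̄≈κ*τ (bar-+ _ _) ⟩
        κ * τ * (bar (η₁ x) + bar (κ * η₂ x))           ≈⟨ *-congˡ (+-cong (bar-ι _)
                                                             (trans (bar-* _ _) (*-cong κ̄≈κ*ω (bar-ι _)))) ⟩
        κ * τ * (η₁ x + κ * ω * η₂ x)                   ≈⟨ solve 5 (λ κ τ ω a b →
                                                             κ :* τ :* (a :+ κ :* ω :* b) :=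
                                                             τ :* (κ :* κ :* ω :* b :+ κ :* a)) refl κ τ ω (η₁ x) (η₂ x) ⟩
        τ * (κ * κ * ω * η₂ x + κ * η₁ x)               ≈⟨ *-congˡ (+-congʳ (trans (*-congʳ κ*κ*ω≈1) (*-identityˡ _))) ⟩
        τ * (η₂ x + κ * η₁ x)                           ∎

      -- Stated symmetrically in order to serve twice: for A as it stands, and for B with x, x̄ and
      -- the two coordinates exchanged.
      diagonalise : ∀ {y z} a b → y ≈ τ * (a + κ * b) → z ≈ τ * (b + κ * a) → y + ω * z ≈ τ * τ * a
      diagonalise {y} {z} a b y≈ z≈ = begin
        y + ω * z                                        ≈⟨ +-cong y≈ (*-congˡ z≈) ⟩
        τ * (a + κ * b) + ω * (τ * (b + κ * a))          ≈⟨ solve 5 (λ τ κ ω a b →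
                                                              τ :* (a :+ κ :* b) :+ ω :* (τ :* (b :+ κ :* a)) :=
                                                              τ :* (con 1 :+ κ :* ω) :* a :+ τ :* (ω :+ κ) :* b)
                                                              refl τ κ ω a b ⟩
        -- The solver returns the coefficient τ (1 + κω) of a, and `1# + κ * ω` is `τ` by
        -- definition; hence the scalar τ². The coefficient of b vanishes because κ = -ω.
        τ * τ * a + τ * (ω + κ) * b                      ≈⟨ +-congˡ (*-congʳ (trans (*-congˡ (-‿inverseʳ ω)) (zeroʳ τ))) ⟩
        τ * τ * a + 0# * b                               ≈⟨ +-congˡ (zeroˡ b) ⟩
        τ * τ * a + 0#                                   ≈⟨ +-identityʳ _ ⟩
        τ * τ * a                                        ∎

      σ : Carrier
      σ = τ * τ

      σ^_≉0 : ∀ n → σ ^ n ≉ 0#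
      σ^ n ≉0 = x≉0⇒x^n≉0 (x≉0∧y≉0⇒xy≉0 τ≉0 τ≉0) n

      A^n≈ : ∀ n x → A x ^ n ≈ σ ^ n * ι (proj₁ (η x) F.^ n)
      A^n≈ n x = trans (^-congˡ n (diagonalise _ _ (x≈ x) (x̄≈ x)))
        (trans (^-distrib-* σ (η₁ x) n) (*-congˡ (sym (ι-^ _ n))))

      B^n≈ : ∀ n x → B x ^ n ≈ σ ^ n * ι (proj₂ (η x) F.^ n)
      B^n≈ n x = trans (^-congˡ n (diagonalise _ _ (x̄≈ x) (x≈ x)))
        (trans (^-distrib-* σ (η₂ x) n) (*-congˡ (sym (ι-^ _ n))))

      -- The powers of `σ` that A and B contribute are the same in both terms, so they can be
      -- absorbed into b.
      split-equivalence : ∀ b f g → b ≉ 0# → (∀ x → f x ≈ combination b κ (g (η x))) →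
                          LinearlyEquivalent K/F F×F f g
      split-equivalence b f g b≉0 f≈ = combination b κ , η ,
        combination-iso b≉0 independent , inverse-iso F×F K/F τ-iso , f≈

      extract : ∀ b κ s x y → b * (s * x + κ * (s * y)) ≈ b * s * (x + κ * y)
      extract = solve 5 (λ b κ s x y → b :* (s :* x :+ κ :* (s :* y)) := b :* s :* (x :+ κ :* y)) refl

    f₁-equivalent-q≡2 : LinearlyEquivalent K/F F×F (f₁ q zero)
      (λ (x , y) → x F.^ (Q Nat.+ R Nat.+ S) , y F.^ (Q Nat.+ R Nat.+ S))
    f₁-equivalent-q≡2 = split-equivalence (β₁ ⁻¹ * σ ^ r) (f₁ q zero) (λ (x , y) → x F.^ r , y F.^ r)
      (x≉0∧y≉0⇒xy≉0 β₁⁻¹≉0 (σ^ r ≉0)) λ x → begin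
      f₁ q zero x
        ≈⟨ f₁-formula x ⟩
      β₁ ⁻¹ * (A x ^ r + κ * B x ^ r)
        ≈⟨ *-congˡ (+-cong (A^n≈ r x) (*-congˡ (B^n≈ r x))) ⟩
      β₁ ⁻¹ * (σ ^ r * ι (proj₁ (η x) F.^ r) + κ * (σ ^ r * ι (proj₂ (η x) F.^ r)))
        ≈⟨ extract (β₁ ⁻¹) κ (σ ^ r) (ι (proj₁ (η x) F.^ r)) (ι (proj₂ (η x) F.^ r)) ⟩
      β₁ ⁻¹ * σ ^ r * (ι (proj₁ (η x) F.^ r) + κ * ι (proj₂ (η x) F.^ r)) ∎

    f₂-equivalent-q≡2 : LinearlyEquivalent K/F F×F (f₂ q zero)
      (λ (x , y) → (x F.^ (Q Nat.+ S)) F.* (y F.^ R) , (x F.^ R) F.* (y F.^ (Q Nat.+ S)))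
    f₂-equivalent-q≡2 = split-equivalence
      (β₂ ⁻¹ * (σ ^ (Q Nat.+ S) * σ ^ R)) (f₂ q zero)
      (λ (x , y) → (x F.^ (Q Nat.+ S)) F.* (y F.^ R) , (x F.^ R) F.* (y F.^ (Q Nat.+ S)))
      (x≉0∧y≉0⇒xy≉0 β₂⁻¹≉0 (x≉0∧y≉0⇒xy≉0 (σ^ (Q Nat.+ S) ≉0) (σ^ R ≉0))) λ x → begin
      f₂ q zero x
        ≈⟨ f₂-formula x ⟩
      β₂ ⁻¹ * (A x ^ (Q Nat.+ S) * B x ^ R + κ * (B x ^ (Q Nat.+ S) * A x ^ R))
        ≈⟨ *-congˡ (+-cong
             (gather (A^n≈ (Q Nat.+ S) x) (B^n≈ R x))
             (*-congˡ (trans (gather (B^n≈ (Q Nat.+ S) x) (A^n≈ R x))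
                             (*-congˡ (ι.⟦⟧-cong (F.*-comm _ _)))))) ⟩
      β₂ ⁻¹ * (s * ι (g₁ x) + κ * (s * ι (g₂ x)))
        ≈⟨ extract (β₂ ⁻¹) κ s (ι (g₁ x)) (ι (g₂ x)) ⟩
      β₂ ⁻¹ * s * (ι (g₁ x) + κ * ι (g₂ x)) ∎
      where
      s : Carrier
      s = σ ^ (Q Nat.+ S) * σ ^ R
      g₁ g₂ : Carrier → F.Carrier
      g₁ x = (proj₁ (η x) F.^ (Q Nat.+ S)) F.* (proj₂ (η x) F.^ R)
      g₂ x = (proj₁ (η x) F.^ R) F.* (proj₂ (η x) F.^ (Q Nat.+ S))
      gather : ∀ {x y s t a b} → x ≈ s * ι a → y ≈ t * ι b → x * y ≈ s * t * ι (a F.* b)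
      gather {s = s} {t} {a} {b} x≈ y≈ = trans (*-cong x≈ y≈) (trans
        (solve 4 (λ s t a b → s :* a :* (t :* b) := s :* t :* (a :* b)) refl s t (ι a) (ι b))
        (*-congˡ (sym (ι.*-homo a b))))

  module _ {m ℓm} (V : Module F.commutativeRing m ℓm) where

    -- The target module V is arbitrary, so one statement covers both residue classes of q.
    f₁-reciprocal : ∀ z g → LinearlyEquivalent K/F V (f₁ q zero) g → LinearlyEquivalent K/F V (f₁ q z) g
    f₁-reciprocal zero       g equiv = equiv
    f₁-reciprocal (suc zero) g equiv = precompose-iso K/F V (f₁ q zero) (f₁ q (suc zero)) g
      bar-iso (eval-reciprocal C₁⁽¹⁾-degree (β₁ ⁻¹)) equiv

    f₂-reciprocal : ∀ z g → LinearlyEquivalent K/F V (f₂ q zero) g → LinearlyEquivalent K/F V (f₂ q z) g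
    f₂-reciprocal zero       g equiv = equiv
    f₂-reciprocal (suc zero) g equiv = precompose-iso K/F V (f₂ q zero) (f₂ q (suc zero)) g
      bar-iso (eval-reciprocal C₁⁽²⁾-degree (β₂ ⁻¹)) equiv

open Nat using (_+_; _*_; _^_)

theorem1p7 :
    ∀ {c ℓ c′ ℓ′} (p k q Q R S : ℕ) →
    Prime p → p ≢ 3 → 1 ≤ k → q ≡ p ^ k →
    PowerOf p Q → PowerOf p R → PowerOf p S →
    (F : Field c ℓ) (K : Field c′ ℓ′) →
    HasCardinality (Field.setoid F) q →
    HasCardinality (Field.setoid K) (q ^ 2) →
    (ι : Field.Carrier F → Field.Carrier K)
    (ι-hom : IsRingHomomorphism (Field.rawRing F) (Field.rawRing K) ι) →
    (ω : Field.Carrier K) → Field._≉_ K ω (Field.0# K) → Field.HasOrder K ω 3 →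
    (z : Fin 2) →
    let open Field F using () renaming (_*_ to _*ᶠ_)
        open Field F using () renaming (_^_ to _^ᶠ_)
        open Field K using () renaming (_^_ to _^ᵏ_)
        open Families K ω Q R S using (f₁)
        open Families K ω Q R S using (f₂)
        K/F = extensionModule F K ι-hom
        F×F = squareModule F
    in
    (q % 3 ≡ 1 →
      LinearlyEquivalent K/F K/F (f₁ q z) (λ x → x ^ᵏ (Q + R + S)))
    ×
    (q % 3 ≡ 2 →
      LinearlyEquivalent K/F F×F (f₁ q z)
        (λ (x , y) → x ^ᶠ (Q + R + S) , y ^ᶠ (Q + R + S)))
    ×
    (q % 3 ≡ 1 →
      LinearlyEquivalent K/F K/F (f₂ q z) (λ x → x ^ᵏ (Q + q * R + S)))
    ×
    (q % 3 ≡ 2 →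
      LinearlyEquivalent K/F F×F (f₂ q z)
        (λ (x , y) → (x ^ᶠ (Q + S)) *ᶠ (y ^ᶠ R) , (x ^ᶠ R) *ᶠ (y ^ᶠ (Q + S))))
theorem1p7 p k q Q R S p-prime p≢3 _ q≡p^k Q-power R-power S-power
           F K cardF cardK ι ι-hom ω ω≉0 ω-order z =
    (λ q≡1 → f₁-reciprocal K/F z (K._^ (Q + R + S)) (f₁-equivalent-q≡1 q≡1))
  , (λ q≡2 → f₁-reciprocal F×F z (λ (x , y) → x F.^ (Q + R + S) , y F.^ (Q + R + S)) (f₁-equivalent-q≡2 q≡2))
  , (λ q≡1 → f₂-reciprocal K/F z (K._^ (Q + q * R + S)) (f₂-equivalent-q≡1 q≡1))
  , (λ q≡2 → f₂-reciprocal F×F z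
      (λ (x , y) → (x F.^ (Q + S)) F.* (y F.^ R) , (x F.^ R) F.* (y F.^ (Q + S))) (f₂-equivalent-q≡2 q≡2))
  where
  module F = Field F
  module K = Field K
  K/F = extensionModule F K ι-hom
  F×F = squareModule F
  open Equivalences {k = k} p-prime p≢3 q≡p^k Q-power R-power S-power
         F K cardF cardK ι-hom ω ω≉0 ω-order
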